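{- Let $D$ be an oriented multigraph with $m$ arcs and maximum degree $\Delta(D)\le 5$. Then $\mathrm{fas}(D)\le m/3$.
   Context: All digraphs are finite. An oriented multigraph is a directed multigraph (parallel arcs allowed) without loops and without directed cycles of length 2; arcs are counted with multiplicity. The degree $d_D(v)$ of a vertex $v$ is the number of arcs incident with $v$ (the sum of its out-degree and in-degree, counted with multiplicity), and $\Delta(D)$ is the maximum degree of a vertex of $D$. A set $F$ of arcs of $D$ is a feedback arc set if $D-F$ has no directed cycle; $\mathrm{fas}(D)$ is the minimum number of arcs in a feedback arc set of $D$. -}

module Defs where

open import Data.Fin using (Fin; zero; suc; inject₁; fromℕ; _≟_)
open import Data.Fin.Properties using (any?; all?; injective⇒≤)
open import Data.Fin.Subset using (Subset; _∉_; ∣_∣; ⊤)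
open import Data.Fin.Subset.Properties using (_∈?_; anySubset?; ∈⊤)
open import Data.List using (length; filter; map; allFin)
open import Data.List.Extrema.Nat using (max)
open import Data.Nat using (ℕ; zero; suc; _+_; _≤_; _<_; _<?_)
open import Data.Nat.Induction using (<-wellFounded)
open import Data.Nat.Properties using (anyUpTo?; ≮⇒≥)
open import Data.Product using (Σ; ∃; _×_; _,_; proj₁; proj₂)
open import Data.Vec using (Vec; []; _∷_; lookup; tabulate)
open import Data.Vec.Properties using (lookup∘tabulate)
open import Function using (_∘_)
open import Function.Definitions using (Injective)
open import Induction.WellFounded using (Acc; acc)
open import Relation.Binary.PropositionalEquality using (_≡_; _≢_; sym; trans; cong; subst)
open import Relation.Nullary using (¬_; Dec; yes; no)
open import Relation.Nullary.Decidable using (map′; ¬?; _×-dec_; _→-dec_)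
open import Relation.Unary using (Decidable)

-- Directed multigraph: distinct elements of A may have the same endpoints.
record Digraph (V A : Set) : Set where
  field
    src tgt : A → V

open Digraph public

-- A directed cycle of length suc k, given by its arcs in cyclic order; the
-- vertices it visits are the sources of these arcs and must be distinct.
record IsDirectedCycle {V A : Set} (G : Digraph V A) {k : ℕ} (c : Fin (suc k) → A) : Set where
  field
    consecutive : (i : Fin k) → tgt G (c (inject₁ i)) ≡ src G (c (suc i))
    closed      : tgt G (c (fromℕ k)) ≡ src G (c zero)
    simple      : Injective _≡_ _≡_ (src G ∘ c)

open IsDirectedCycle public

Acyclic : {V A : Set} → Digraph V A → Set
Acyclic {A = A} G = ∀ {k} (c : Fin (suc k) → A) → ¬ IsDirectedCycle G c

record IsOriented {V A : Set} (G : Digraph V A) : Set where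
  field
    noLoops   : (e : A) → src G e ≢ tgt G e
    no2Cycles : (c : Fin 2 → A) → ¬ IsDirectedCycle G c

open IsOriented public

module _ {n m : ℕ} (D : Digraph (Fin n) (Fin m)) where

  outDegree inDegree degree : Fin n → ℕ
  outDegree v = length (filter (λ e → src D e ≟ v) (allFin m))
  inDegree  v = length (filter (λ e → tgt D e ≟ v) (allFin m))
  degree    v = outDegree v + inDegree v

  -- The maximum degree, taken to be 0 when there are no vertices.
  Δ : ℕ
  Δ = max 0 (map degree (allFin n))

  deleteArcs : (F : Subset m) → Digraph (Fin n) (∃ λ e → e ∉ F)
  deleteArcs F .src = src D ∘ proj₁
  deleteArcs F .tgt = tgt D ∘ proj₁

  IsFeedbackArcSet : Subset m → Set
  IsFeedbackArcSet F = Acyclic (deleteArcs F)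

  IsMinimumFeedbackArcSet : Subset m → Set
  IsMinimumFeedbackArcSet F =
    IsFeedbackArcSet F × (∀ F′ → IsFeedbackArcSet F′ → ∣ F ∣ ≤ ∣ F′ ∣)

anyVec? : ∀ {m k} {P : Vec (Fin m) k → Set} → Decidable P → Dec (∃ P)
anyVec? {k = zero} P? = map′ ([] ,_) (λ { ([] , p) → p }) (P? [])
anyVec? {k = suc k} P? = map′
  (λ { (x , xs , p) → x ∷ xs , p })
  (λ { (x ∷ xs , p) → x , xs , p })
  (any? λ x → anyVec? λ xs → P? (x ∷ xs))

module _ {n m : ℕ} (D : Digraph (Fin n) (Fin m)) where

  isDirectedCycle? : ∀ {k} (c : Fin (suc k) → Fin m) → Dec (IsDirectedCycle D c)
  isDirectedCycle? {k} c = map′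
    (λ { (p , q , r) → record { consecutive = p ; closed = q ; simple = λ {i} {j} → r i j } })
    (λ C → consecutive C , closed C , λ i j → simple C)
    (all? (λ i → tgt D (c (inject₁ i)) ≟ src D (c (suc i)))
      ×-dec (tgt D (c (fromℕ k)) ≟ src D (c zero))
      ×-dec all? (λ i → all? λ j → (src D (c i) ≟ src D (c j)) →-dec (i ≟ j)))

  isDirectedCycle-cong : ∀ {k} {c d : Fin (suc k) → Fin m} → (∀ i → c i ≡ d i) →
                         IsDirectedCycle D c → IsDirectedCycle D d
  isDirectedCycle-cong {k} c≗d C = record
    { consecutive = λ i → trans (sym (cong (tgt D) (c≗d (inject₁ i))))
                            (trans (consecutive C i) (cong (src D) (c≗d (suc i))))
    ; closed      = trans (sym (cong (tgt D) (c≗d (fromℕ k))))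
                      (trans (closed C) (cong (src D) (c≗d zero)))
    ; simple      = λ {i} {j} eq → simple C
                      (trans (cong (src D) (c≗d i)) (trans eq (sym (cong (src D) (c≗d j)))))
    }

  -- A search over finitely many cycles: injective⇒≤ bounds the length by n.
  isFeedbackArcSet? : Decidable (IsFeedbackArcSet D)
  isFeedbackArcSet? F = map′ to from (¬? (anyUpTo? cycle? n))
    where
    CycleAvoidingF : ℕ → Set
    CycleAvoidingF k =
      Σ (Vec (Fin m) (suc k)) λ c → IsDirectedCycle D (lookup c) × (∀ i → lookup c i ∉ F)

    cycle? : Decidable CycleAvoidingF
    cycle? k = anyVec? λ c →
      isDirectedCycle? (lookup c) ×-dec all? (λ i → ¬? (lookup c i ∈? F))

    to : ¬ (∃ λ k → k < n × CycleAvoidingF k) → IsFeedbackArcSet D F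
    to none {k} c C = none (k , injective⇒≤ (simple C) , tabulate (proj₁ ∘ c)
      , isDirectedCycle-cong (λ i → sym (lookup∘tabulate (proj₁ ∘ c) i))
          (record { consecutive = consecutive C ; closed = closed C ; simple = simple C })
      , λ i → subst (_∉ F) (sym (lookup∘tabulate (proj₁ ∘ c) i)) (proj₂ (c i)))

    from : IsFeedbackArcSet D F → ¬ (∃ λ k → k < n × CycleAvoidingF k)
    from fb (k , _ , c , C , c∉F) = fb (λ i → lookup c i , c∉F i)
      (record { consecutive = consecutive C ; closed = closed C ; simple = simple C })

  ⊤-isFeedbackArcSet : IsFeedbackArcSet D ⊤
  ⊤-isFeedbackArcSet c C = proj₂ (c zero) ∈⊤

  minimumFeedbackArcSet : ∃ (IsMinimumFeedbackArcSet D)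
  minimumFeedbackArcSet = go ⊤ ⊤-isFeedbackArcSet (<-wellFounded _)
    where
    go : (F : Subset m) → IsFeedbackArcSet D F → Acc _<_ ∣ F ∣ → ∃ (IsMinimumFeedbackArcSet D)
    go F fb (acc rec) with anySubset? (λ F′ → isFeedbackArcSet? F′ ×-dec (∣ F′ ∣ <? ∣ F ∣))
    ... | yes (F′ , fb′ , F′<F) = go F′ fb′ (rec F′<F)
    ... | no none = F , fb , λ F′ fb′ → ≮⇒≥ λ F′<F → none (F′ , fb′ , F′<F)

  fas : ℕ
  fas = ∣ proj₁ minimumFeedbackArcSet ∣

{-# OPTIONS --safe #-}

-- Bounds are proved on three times the number of backward arcs of an order of the vertices.
-- Inserting v first or last in an order of D ∖ v costs min(d⁺ v, d⁻ v) backward arcs;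
-- and a vertex v with d⁺ v = d⁻ v = 1, in u → v → w, is contracted to an arc u → w or, if there is an
-- arc w → u, deleted together with one such arc at the cost of one backward arc.  These moves suffice.
--
-- If all in- and out-degrees are at most 2, the bound ∑ min(d⁺ x, d⁻ x) is attained.  Call x up if
-- (d⁻ x, d⁺ x) = (1, 2) and down if it is (2, 1).  Where no move applies directly, every arc from an
-- up vertex ends in a down vertex and every arc into a down vertex starts in an up vertex.  Then
-- deleting a vertex of type (2, 2) lowers the bound by 2 at the vertex and by 1 for each of its arcs,
-- which pays for two backward arcs; if there is none, deleting an up vertex makes a down vertex
-- contractible.
--
-- If all degrees are at most 5, the bound m is attained, and even m - 1 if some vertex has degree 3.
-- For the latter, let d⁻ c = 2 and let c → x be the only arc leaving c: if x has degree 4, delete c,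
-- after which x has degree 3; otherwise delete x and then the sink c.  For the former, deleting a
-- vertex a of type (2, 3) costs 6 for 5 arcs, and any in-neighbour of a makes up for the missing 1.
-- When only vertices of type (2, 2) are left, ∑ min(d⁺ x, d⁻ x) ≤ m.
module Submission where

open import Data.Bool using (true)
open import Data.Fin using (Fin; zero; suc; inject₁; fromℕ; _≟_)
open import Data.Fin.Properties using (any?)
open import Data.Fin.Subset using (Subset; ∣_∣)
open import Data.List using (List; []; _∷_; length; filter; map; allFin; tabulate)
open import Data.List.Extrema.Nat using (xs≤max)
import Data.List.Membership.DecPropositional as DecMembership
open import Data.List.Membership.Propositional using (_∈_; _∉_)
open import Data.List.Membership.Propositional.Properties using (∈-filter⁺; ∈-filter⁻; ∈-map⁺; ∈-map⁻; ∈-allFin)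
open import Data.List.Properties using (length-map; length-tabulate)
open import Data.List.Relation.Unary.All as All using (All; []; _∷_)
open import Data.List.Relation.Unary.AllPairs using (AllPairs; []; _∷_)
open import Data.List.Relation.Unary.Any using (here; there)
open import Data.Nat as ℕ hiding (_≟_)
open import Data.Nat.Induction using (<-wellFounded)
open import Data.Nat.Properties hiding (_≟_)
open import Data.Nat.Tactic.RingSolver using (solve-∀)
open import Data.Product using (∃; _×_; _,_; proj₁; proj₂; swap)
open import Data.Product.Properties using (≡-dec)
open import Data.Sum using (_⊎_; inj₁; inj₂)
import Data.Vec as Vec
import Data.Vec.Properties as Vec
open import Defs
open import Function using (_∘_; case_of_)
open import Induction.WellFounded using (Acc; acc)
open import Relation.Binary.PropositionalEquality
open import Relation.Nullary using (¬_; Dec; yes; no; does; contradiction)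
open import Relation.Nullary.Decidable using (¬?; _×-dec_; dec-true)
open import Relation.Unary using (Decidable)

private
  variable
    A B : Set
    n : ℕ

-- Indicators and finite sums.

⟦_⟧ : {P : Set} → Dec P → ℕ
⟦ yes _ ⟧ = 1
⟦ no _ ⟧  = 0

⟦⟧-yes : {P : Set} (d : Dec P) → P → ⟦ d ⟧ ≡ 1
⟦⟧-yes (yes _) _ = refl
⟦⟧-yes (no ¬p) p = contradiction p ¬p

⟦⟧-no : {P : Set} (d : Dec P) → ¬ P → ⟦ d ⟧ ≡ 0
⟦⟧-no (yes p) ¬p = contradiction p ¬p
⟦⟧-no (no _)  _  = refl

⟦⟧≤1 : {P : Set} (d : Dec P) → ⟦ d ⟧ ≤ 1
⟦⟧≤1 (yes _) = ≤-refl
⟦⟧≤1 (no _)  = z≤n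

⟦⟧-⇔ : {P Q : Set} (d : Dec P) (e : Dec Q) → (P → Q) → (Q → P) → ⟦ d ⟧ ≡ ⟦ e ⟧
⟦⟧-⇔ (yes p) e f g = sym (⟦⟧-yes e (f p))
⟦⟧-⇔ (no ¬p) e f g = sym (⟦⟧-no e (¬p ∘ g))

⟦⟧-⇒ : {P Q : Set} (d : Dec P) (e : Dec Q) → (P → Q) → ⟦ d ⟧ ≤ ⟦ e ⟧
⟦⟧-⇒ (yes p) e f = ≤-reflexive (sym (⟦⟧-yes e (f p)))
⟦⟧-⇒ (no ¬p) e f = z≤n

⟦⟧⁻ : {P : Set} (d : Dec P) → 0 < ⟦ d ⟧ → P
⟦⟧⁻ (yes p) _ = p

∑ : (A → ℕ) → List A → ℕ
∑ f []       = 0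
∑ f (x ∷ xs) = f x + ∑ f xs

∑-mono : ∀ {f g : A → ℕ} xs → (∀ {x} → x ∈ xs → f x ≤ g x) → ∑ f xs ≤ ∑ g xs
∑-mono []       f≤g = z≤n
∑-mono (x ∷ xs) f≤g = +-mono-≤ (f≤g (here refl)) (∑-mono xs (f≤g ∘ there))

∑-cong : ∀ {f g : A → ℕ} xs → (∀ {x} → x ∈ xs → f x ≡ g x) → ∑ f xs ≡ ∑ g xs
∑-cong xs f≡g = ≤-antisym (∑-mono xs (≤-reflexive ∘ f≡g)) (∑-mono xs (≤-reflexive ∘ sym ∘ f≡g))

∑-+ : ∀ (f g : A → ℕ) xs → ∑ (λ x → f x + g x) xs ≡ ∑ f xs + ∑ g xs
∑-+ f g []       = refl
∑-+ f g (x ∷ xs) rewrite ∑-+ f g xs = interchange (f x) (g x) (∑ f xs) (∑ g xs)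
  where
  interchange : ∀ a b c d → a + b + (c + d) ≡ a + c + (b + d)
  interchange = solve-∀

∑-0 : ∀ (xs : List A) → ∑ (λ _ → 0) xs ≡ 0
∑-0 []       = refl
∑-0 (_ ∷ xs) = ∑-0 xs

∑-1 : ∀ (xs : List A) → ∑ (λ _ → 1) xs ≡ length xs
∑-1 []       = refl
∑-1 (_ ∷ xs) = cong suc (∑-1 xs)

∑-swap : ∀ (f : A → B → ℕ) xs ys → ∑ (λ x → ∑ (f x) ys) xs ≡ ∑ (λ y → ∑ (λ x → f x y) xs) ys
∑-swap f []       ys = sym (∑-0 ys)
∑-swap f (x ∷ xs) ys = trans (cong (∑ (f x) ys +_) (∑-swap f xs ys)) (sym (∑-+ (f x) _ ys))

∑-map : ∀ (f : B → ℕ) (g : A → B) xs → ∑ f (map g xs) ≡ ∑ (f ∘ g) xs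
∑-map f g []       = refl
∑-map f g (x ∷ xs) = cong (f (g x) +_) (∑-map f g xs)

∑-*ʳ : ∀ (f : A → ℕ) k xs → ∑ (λ x → f x * k) xs ≡ ∑ f xs * k
∑-*ʳ f k []       = refl
∑-*ʳ f k (x ∷ xs) = trans (cong (f x * k +_) (∑-*ʳ f k xs)) (sym (*-distribʳ-+ k (f x) (∑ f xs)))

∑-∈ : ∀ (f : A → ℕ) {x xs} → x ∈ xs → f x ≤ ∑ f xs
∑-∈ f (here refl)  = m≤m+n _ _
∑-∈ f (there x∈xs) = ≤-trans (∑-∈ f x∈xs) (m≤n+m _ _)

∑-positive : ∀ (f : A → ℕ) xs → 0 < ∑ f xs → ∃ λ x → x ∈ xs × 0 < f x
∑-positive f (x ∷ xs) 0<s with f x in eq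
... | suc _ = x , here refl , subst (0 <_) (sym eq) z<s
... | zero  = let y , y∈xs , 0<fy = ∑-positive f xs 0<s in y , there y∈xs , 0<fy

∑-filter : {P : A → Set} (P? : Decidable P) (f : A → ℕ) → ∀ xs →
           ∑ f (filter P? xs) ≡ ∑ (λ x → ⟦ P? x ⟧ * f x) xs
∑-filter P? f []       = refl
∑-filter P? f (x ∷ xs) with P? x
... | yes _ = cong₂ _+_ (sym (+-identityʳ (f x))) (∑-filter P? f xs)
... | no  _ = ∑-filter P? f xs

-- Removing one occurrence of `x` is recorded through the sums of all `f` at once, so that lengths,
-- degrees and backward counts are instances of one equation.
∑-extract : ∀ {x : A} {xs} → x ∈ xs →
            ∃ λ ys → (∀ {y} → y ∈ ys → y ∈ xs) × (∀ f → ∑ f xs ≡ f x + ∑ f ys)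
∑-extract {xs = x ∷ xs} (here refl) = xs , there , λ _ → refl
∑-extract {x = x} {xs = z ∷ xs} (there x∈xs) with ∑-extract x∈xs
... | ys , ys⊆xs , eq = z ∷ ys
  , (λ { (here p) → here p ; (there p) → there (ys⊆xs p) })
  , λ f → trans (cong (f z +_) (eq f)) (exchange (f z) (f x) (∑ f ys))
  where
  exchange : ∀ a b c → a + (b + c) ≡ b + (a + c)
  exchange = solve-∀

∑-tabulate : ∀ {n} (f : A → ℕ) (g : Fin n → A) → ∑ f (tabulate g) ≡ ∑ (f ∘ g) (allFin n)
∑-tabulate {n = zero}  f g = refl
∑-tabulate {n = suc n} f g = cong (f (g zero) +_)
  (trans (∑-tabulate f (g ∘ suc)) (sym (∑-tabulate (f ∘ g) suc)))

∑-δ : ∀ {n} (v : Fin n) → ∑ (λ x → ⟦ v ≟ x ⟧) (allFin n) ≡ 1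
∑-δ {suc n} zero = cong suc (trans (∑-tabulate (λ x → ⟦ zero {n} ≟ x ⟧) suc)
  (trans (∑-cong (allFin n) (λ {x} _ → ⟦⟧-no (zero {n} ≟ suc x) λ ())) (∑-0 (allFin n))))
∑-δ {suc n} (suc v) = trans (∑-tabulate (λ x → ⟦ suc v ≟ x ⟧) suc)
  (trans (∑-cong (allFin n) (λ {x} _ → ⟦⟧-⇔ (suc v ≟ suc x) (v ≟ x) (λ { refl → refl }) (cong suc))) (∑-δ v))

bounded : ∀ {n} (r : Fin n → ℕ) → ∃ λ M → ∀ x → r x ≤ M
bounded {n} r = ∑ r (allFin n) , λ x → ∑-∈ r (∈-allFin x)

-- Lists of arcs and their degrees

Arcs : ℕ → Set
Arcs n = List (Fin n × Fin n)

opaque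

  d⁺ d⁻ : Fin n → Arcs n → ℕ
  d⁺ x = ∑ (λ e → ⟦ proj₁ e ≟ x ⟧)
  d⁻ x = ∑ (λ e → ⟦ proj₂ e ≟ x ⟧)

  mult : Fin n → Fin n → Arcs n → ℕ
  mult x y = ∑ (λ e → ⟦ proj₁ e ≟ x ⟧ * ⟦ proj₂ e ≟ y ⟧)

-- The case `u` = `v` excludes loops, so one condition covers loops and 2-cycles.
Oriented : Arcs n → Set
Oriented G = ∀ {u v} → (u , v) ∈ G → (v , u) ∉ G

avoids? : (v : Fin n) → Decidable (λ (e : Fin n × Fin n) → proj₁ e ≢ v × proj₂ e ≢ v)
avoids? v e = ¬? (proj₁ e ≟ v) ×-dec ¬? (proj₂ e ≟ v)

infixl 6 _∖_

opaque

  -- The vertex type is kept and `v` stays behind as an isolated vertex; inductions therefore run on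
  -- the number of arcs.
  _∖_ : Arcs n → Fin n → Arcs n
  G ∖ v = filter (avoids? v) G

  ∖-⊆ : ∀ (G : Arcs n) v {e} → e ∈ G ∖ v → e ∈ G
  ∖-⊆ G v = proj₁ ∘ ∈-filter⁻ (avoids? v) {xs = G}

  ∈-∖⁺ : ∀ {G : Arcs n} {v x y} → (x , y) ∈ G → x ≢ v → y ≢ v → (x , y) ∈ G ∖ v
  ∈-∖⁺ {v = v} p x≢v y≢v = ∈-filter⁺ (avoids? v) p (x≢v , y≢v)

op : Arcs n → Arcs n
op = map swap

oriented-⊆ : {G H : Arcs n} → (∀ {e} → e ∈ H → e ∈ G) → Oriented G → Oriented H
oriented-⊆ H⊆G o p q = o (H⊆G p) (H⊆G q)

oriented-∖ : ∀ {G : Arcs n} v → Oriented G → Oriented (G ∖ v)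
oriented-∖ {G = G} v = oriented-⊆ (∖-⊆ G v)

∈-op⁻ : ∀ {G : Arcs n} {u v} → (u , v) ∈ op G → (v , u) ∈ G
∈-op⁻ p with ∈-map⁻ swap p
... | _ , q , refl = q

oriented-op : {G : Arcs n} → Oriented G → Oriented (op G)
oriented-op o p q = o (∈-op⁻ p) (∈-op⁻ q)

opaque
  unfolding d⁺ d⁻

  d⁺-op : ∀ x (G : Arcs n) → d⁺ x (op G) ≡ d⁻ x G
  d⁺-op x = ∑-map _ swap

  d⁻-op : ∀ x (G : Arcs n) → d⁻ x (op G) ≡ d⁺ x G
  d⁻-op x = ∑-map _ swap

distinct : ∀ {G : Arcs n} {u v} → Oriented G → (u , v) ∈ G → u ≢ v
distinct o p refl = o p p

module _ {G : Arcs n} where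

  opaque
    unfolding d⁺ d⁻ mult _∖_

    inNeighbour : ∀ {v} → 0 < d⁻ v G → ∃ λ u → (u , v) ∈ G
    inNeighbour {v} p with ∑-positive _ G p
    ... | (u , w) , e∈G , 0<δ = u , subst (λ w → (u , w) ∈ G) (⟦⟧⁻ (w ≟ v) 0<δ) e∈G

    outNeighbour : ∀ {v} → 0 < d⁺ v G → ∃ λ w → (v , w) ∈ G
    outNeighbour {v} p with ∑-positive _ G p
    ... | (u , w) , e∈G , 0<δ = w , subst (λ u → (u , w) ∈ G) (⟦⟧⁻ (u ≟ v) 0<δ) e∈G

    d⁺-positive : ∀ {u v} → (u , v) ∈ G → 0 < d⁺ u G
    d⁺-positive {u} p = ≤-trans (≤-reflexive (sym (⟦⟧-yes (u ≟ u) refl))) (∑-∈ (λ e → ⟦ proj₁ e ≟ u ⟧) p)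

    d⁻-positive : ∀ {u v} → (u , v) ∈ G → 0 < d⁻ v G
    d⁻-positive {v = v} p = ≤-trans (≤-reflexive (sym (⟦⟧-yes (v ≟ v) refl))) (∑-∈ (λ e → ⟦ proj₂ e ≟ v ⟧) p)

    mult-positive : ∀ {u v} → (u , v) ∈ G → 0 < mult u v G
    mult-positive {u} {v} p = ≤-trans
      (≤-reflexive (sym (cong₂ _*_ (⟦⟧-yes (u ≟ u) refl) (⟦⟧-yes (v ≟ v) refl))))
      (∑-∈ (λ e → ⟦ proj₁ e ≟ u ⟧ * ⟦ proj₂ e ≟ v ⟧) p)

    mult⁻ : ∀ {u v} → 0 < mult u v G → (u , v) ∈ G
    mult⁻ {u} {v} p with ∑-positive _ G p
    ... | (a , b) , e∈G , 0<δ with a ≟ u | b ≟ v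
    ... | yes refl | yes refl = e∈G

    mult-zero : ∀ {u v} → (u , v) ∉ G → mult u v G ≡ 0
    mult-zero {u} {v} e∉G with mult u v G in eq
    ... | zero  = refl
    ... | suc _ = contradiction (mult⁻ (subst (0 <_) (sym eq) z<s)) e∉G

    mult≤d⁺ : ∀ u v → mult u v G ≤ d⁺ u G
    mult≤d⁺ u v = ∑-mono G λ {e} _ → ≤-trans (*-monoʳ-≤ ⟦ proj₁ e ≟ u ⟧ (⟦⟧≤1 (proj₂ e ≟ v))) (≤-reflexive (*-identityʳ _))

    ∑-mult-in : ∀ v → ∑ (λ x → mult x v G) (allFin n) ≡ d⁻ v G
    ∑-mult-in v = trans (∑-swap (λ x e → ⟦ proj₁ e ≟ x ⟧ * ⟦ proj₂ e ≟ v ⟧) (allFin n) G)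
      (∑-cong G λ {e} _ → trans (∑-*ʳ (λ x → ⟦ proj₁ e ≟ x ⟧) ⟦ proj₂ e ≟ v ⟧ (allFin n))
        (trans (cong (_* ⟦ proj₂ e ≟ v ⟧) (∑-δ (proj₁ e))) (*-identityˡ _)))

    ∑-mult-out : ∀ v → ∑ (λ x → mult v x G) (allFin n) ≡ d⁺ v G
    ∑-mult-out v = trans (∑-swap (λ x e → ⟦ proj₁ e ≟ v ⟧ * ⟦ proj₂ e ≟ x ⟧) (allFin n) G)
      (∑-cong G λ {e} _ → trans
        (∑-cong (allFin n) λ {x} _ → *-comm ⟦ proj₁ e ≟ v ⟧ ⟦ proj₂ e ≟ x ⟧)
        (trans (∑-*ʳ (λ x → ⟦ proj₂ e ≟ x ⟧) ⟦ proj₁ e ≟ v ⟧ (allFin n))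
        (trans (cong (_* ⟦ proj₁ e ≟ v ⟧) (∑-δ (proj₂ e))) (*-identityˡ _))))

    ∑-d⁺ : ∑ (λ x → d⁺ x G) (allFin n) ≡ length G
    ∑-d⁺ = trans (∑-swap (λ x e → ⟦ proj₁ e ≟ x ⟧) (allFin n) G)
      (trans (∑-cong G λ {e} _ → ∑-δ (proj₁ e)) (∑-1 G))

    ∑-∖ : ∀ f v → ∑ f (G ∖ v) ≡ ∑ (λ e → ⟦ avoids? v e ⟧ * f e) G
    ∑-∖ f v = ∑-filter (avoids? v) f G

    ∑-∖-≤ : ∀ f v → ∑ f (G ∖ v) ≤ ∑ f G
    ∑-∖-≤ f v = ≤-trans (≤-reflexive (∑-∖ f v)) (∑-mono G λ {e} _ →
      ≤-trans (*-monoˡ-≤ (f e) (⟦⟧≤1 (avoids? v e))) (≤-reflexive (*-identityˡ _)))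

    d⁺-∖ : ∀ {x v} → x ≢ v → d⁺ x G ≡ d⁺ x (G ∖ v) + mult x v G
    d⁺-∖ {x} {v} x≢v = sym (trans (cong (_+ mult x v G) (∑-∖ _ v))
      (trans (sym (∑-+ _ _ G)) (∑-cong G λ {e} _ → pointwise e)))
      where
      pointwise : ∀ e → ⟦ avoids? v e ⟧ * ⟦ proj₁ e ≟ x ⟧ + ⟦ proj₁ e ≟ x ⟧ * ⟦ proj₂ e ≟ v ⟧
                      ≡ ⟦ proj₁ e ≟ x ⟧
      pointwise (a , b) with a ≟ x | a ≟ v | b ≟ v
      ... | yes refl | yes refl | _     = contradiction refl x≢v
      ... | yes refl | no _     | yes _ = refl
      ... | yes refl | no _     | no _  = refl
      ... | no _     | yes _    | _     = refl
      ... | no _     | no _     | yes _ = refl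
      ... | no _     | no _     | no _  = refl

    d⁻-∖ : ∀ {x v} → x ≢ v → d⁻ x G ≡ d⁻ x (G ∖ v) + mult v x G
    d⁻-∖ {x} {v} x≢v = sym (trans (cong (_+ mult v x G) (∑-∖ _ v))
      (trans (sym (∑-+ _ _ G)) (∑-cong G λ {e} _ → pointwise e)))
      where
      pointwise : ∀ e → ⟦ avoids? v e ⟧ * ⟦ proj₂ e ≟ x ⟧ + ⟦ proj₁ e ≟ v ⟧ * ⟦ proj₂ e ≟ x ⟧
                      ≡ ⟦ proj₂ e ≟ x ⟧
      pointwise (a , b) with b ≟ x | a ≟ v | b ≟ v
      ... | yes refl | _     | yes refl = contradiction refl x≢v
      ... | yes refl | yes _ | no _     = refl
      ... | yes refl | no _  | no _     = refl
      ... | no _     | yes _ | yes _    = refl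
      ... | no _     | yes _ | no _     = refl
      ... | no _     | no _  | yes _    = refl
      ... | no _     | no _  | no _     = refl

    d⁺-∖-self : ∀ v → d⁺ v (G ∖ v) ≡ 0
    d⁺-∖-self v = trans (∑-∖ _ v) (trans (∑-cong G λ {e} _ → pointwise e) (∑-0 G))
      where
      pointwise : ∀ e → ⟦ avoids? v e ⟧ * ⟦ proj₁ e ≟ v ⟧ ≡ 0
      pointwise (a , b) with a ≟ v | b ≟ v
      ... | yes _ | _     = refl
      ... | no _  | yes _ = refl
      ... | no _  | no _  = refl

    -- A loop at `v` would be counted in both degrees; `Oriented` excludes it.
    length-∖ : Oriented G → ∀ v → length G ≡ length (G ∖ v) + (d⁺ v G + d⁻ v G)
    length-∖ o v = sym (trans (cong₂ _+_ (trans (sym (∑-1 (G ∖ v))) (∑-∖ _ v)) (sym (∑-+ _ _ G)))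
      (trans (sym (∑-+ _ _ G)) (trans (∑-cong G pointwise) (∑-1 G))))
      where
      pointwise : ∀ {e} → e ∈ G → ⟦ avoids? v e ⟧ * 1 + (⟦ proj₁ e ≟ v ⟧ + ⟦ proj₂ e ≟ v ⟧) ≡ 1
      pointwise {a , b} p with a ≟ v | b ≟ v
      ... | yes refl | yes refl = contradiction refl (distinct o p)
      ... | yes _    | no _     = refl
      ... | no _     | yes _    = refl
      ... | no _     | no _     = refl

-- Arcs between vertices of equal rank count as backward.
opaque

  backward : (Fin n → ℕ) → Arcs n → ℕ
  backward r = ∑ (λ e → ⟦ r (proj₂ e) ≤? r (proj₁ e) ⟧)

  backward-[] : ∀ (r : Fin n → ℕ) → backward r [] ≡ 0
  backward-[] _ = refl

-- Rankings: insertion of a vertex and reversal.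

Within : Arcs n → ℕ → Set
Within G b = ∃ λ r → 3 * backward r G ≤ b

weaken : ∀ {G : Arcs n} {b c} → Within G b → b ≤ c → Within G c
weaken (r , p) b≤c = r , ≤-trans p b≤c

module _ {G : Arcs n} where

  opaque
    unfolding d⁺ d⁻ backward

    -- With `v` at rank 0 and all other ranks raised by one, arcs out of `v` go forward and only the
    -- arcs into `v` can be new backward arcs.
    insertFirst : (r : Fin n → ℕ) → ∀ v → ∃ λ r′ → backward r′ G ≤ d⁻ v G + backward r (G ∖ v)
    insertFirst r v = r′ , ≤-trans (∑-mono G λ {e} _ → pointwise e)
      (≤-reflexive (trans (∑-+ _ _ G) (cong (d⁻ v G +_) (sym (∑-∖ {G = G} _ v)))))
      where
      r′ : Fin n → ℕ
      r′ x with x ≟ v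
      ... | yes _ = 0
      ... | no _  = suc (r x)
      pointwise : ∀ e → ⟦ r′ (proj₂ e) ≤? r′ (proj₁ e) ⟧
                      ≤ ⟦ proj₂ e ≟ v ⟧ + ⟦ avoids? v e ⟧ * ⟦ r (proj₂ e) ≤? r (proj₁ e) ⟧
      pointwise (a , b) with a ≟ v | b ≟ v
      ... | yes _ | yes _ = s≤s z≤n
      ... | no _  | yes _ = s≤s z≤n
      ... | yes _ | no _  = ≤-refl
      ... | no _  | no _  = ≤-trans (⟦⟧-⇒ _ (r b ≤? r a) s≤s⁻¹) (m≤m+n _ 0)

    -- Here `v` is ranked strictly above a bound on all ranks, since a tie would turn an arc into
    -- `v` backward.
    insertLast : (r : Fin n → ℕ) → ∀ v → ∃ λ r′ → backward r′ G ≤ d⁺ v G + backward r (G ∖ v)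
    insertLast r v = r′ , ≤-trans (∑-mono G λ {e} _ → pointwise e)
      (≤-reflexive (trans (∑-+ _ _ G) (cong (d⁺ v G +_) (sym (∑-∖ {G = G} _ v)))))
      where
      r′ : Fin n → ℕ
      r′ x with x ≟ v
      ... | yes _ = suc (proj₁ (bounded r))
      ... | no _  = r x
      pointwise : ∀ e → ⟦ r′ (proj₂ e) ≤? r′ (proj₁ e) ⟧
                      ≤ ⟦ proj₁ e ≟ v ⟧ + ⟦ avoids? v e ⟧ * ⟦ r (proj₂ e) ≤? r (proj₁ e) ⟧
      pointwise (a , b) with a ≟ v | b ≟ v
      ... | yes _ | _     = ≤-trans (⟦⟧≤1 _) (m≤m+n 1 _)
      ... | no _  | yes _ = ≤-reflexive (⟦⟧-no _ (<⇒≱ (s≤s (proj₂ (bounded r) a))))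
      ... | no _  | no _  = ≤-reflexive (sym (+-identityʳ _))

  -- The cheaper end is chosen: `v` goes last if its out-degree is the minimum, and first otherwise.
  within-insert : ∀ v {b c} → Within (G ∖ v) b → 3 * (d⁺ v G ⊓ d⁻ v G) + b ≤ c → Within G c
  within-insert v {b} {c} (r , p) q with ≤-total (d⁺ v G) (d⁻ v G)
  ... | inj₁ d⁺≤d⁻ rewrite m≤n⇒m⊓n≡m d⁺≤d⁻ =
    let r′ , h = insertLast r v in r′ , (begin
      3 * backward r′ G                     ≤⟨ *-monoʳ-≤ 3 h ⟩
      3 * (d⁺ v G + backward r (G ∖ v))     ≡⟨ *-distribˡ-+ 3 (d⁺ v G) _ ⟩
      3 * d⁺ v G + 3 * backward r (G ∖ v)   ≤⟨ +-monoʳ-≤ (3 * d⁺ v G) p ⟩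
      3 * d⁺ v G + b                        ≤⟨ q ⟩
      c                                     ∎)
    where open ≤-Reasoning
  ... | inj₂ d⁻≤d⁺ rewrite m≥n⇒m⊓n≡n d⁻≤d⁺ =
    let r′ , h = insertFirst r v in r′ , (begin
      3 * backward r′ G                     ≤⟨ *-monoʳ-≤ 3 h ⟩
      3 * (d⁻ v G + backward r (G ∖ v))     ≡⟨ *-distribˡ-+ 3 (d⁻ v G) _ ⟩
      3 * d⁻ v G + 3 * backward r (G ∖ v)   ≤⟨ +-monoʳ-≤ (3 * d⁻ v G) p ⟩
      3 * d⁻ v G + b                        ≤⟨ q ⟩
      c                                     ∎)
    where open ≤-Reasoning

  opaque
    unfolding backward

    -- The ranking is reflected in an upper bound `M` of its values, which makes the truncated
    -- subtraction order-reversing.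
    within-op : ∀ {b} → Within (op G) b → Within G b
    within-op {b} (r , p) = r′ , ≤-trans (*-monoʳ-≤ 3 (≤-trans
      (∑-mono G λ {(u , v)} _ → ⟦⟧-⇒ (r′ v ≤? r′ u) (r u ≤? r v) (reflect u v))
      (≤-reflexive (sym (∑-map _ swap G))))) p
      where
      M : ℕ
      M = proj₁ (bounded r)
      r′ : Fin n → ℕ
      r′ x = M ∸ r x
      reflect : ∀ u v → M ∸ r v ≤ M ∸ r u → r u ≤ r v
      reflect u v h with r u ≤? r v
      ... | yes q = q
      ... | no ¬q = contradiction h (<⇒≱ (∸-monoʳ-< (≰⇒> ¬q) (proj₂ (bounded r) u)))

-- Vertices of in- and out-degree one

oriented-∷ : ∀ {H : Arcs n} {u w} → u ≢ w → (w , u) ∉ H → Oriented H → Oriented ((u , w) ∷ H)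
oriented-∷ u≢w wu∉ o (here refl) (here refl) = u≢w refl
oriented-∷ u≢w wu∉ o (here refl) (there q)   = wu∉ q
oriented-∷ u≢w wu∉ o (there p)   (here refl) = wu∉ p
oriented-∷ u≢w wu∉ o (there p)   (there q)   = o p q

module _ {G : Arcs n} {v : Fin n} (o : Oriented G) (d⁻≡1 : d⁻ v G ≡ 1) (d⁺≡1 : d⁺ v G ≡ 1) where

  -- The unique arcs into and out of `v` are split off from `G`; `decompose` says so for every sum
  -- over arcs, whence `rest` contains no arc at `v`.
  record Through : Set where
    field
      {u w}      : Fin n
      rest       : Arcs n
      u→v        : (u , v) ∈ G
      v→w        : (v , w) ∈ G
      rest-⊆     : ∀ {e} → e ∈ rest → e ∈ G
      decompose  : ∀ f → ∑ f G ≡ f (u , v) + (f (v , w) + ∑ f rest)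

    u≢v : u ≢ v
    u≢v = distinct o u→v

    w≢v : w ≢ v
    w≢v = ≢-sym (distinct o v→w)

    u≢w : u ≢ w
    u≢w u≡w = o u→v (subst (λ x → (v , x) ∈ G) (sym u≡w) v→w)

    opaque
      unfolding d⁺ d⁻

      d⁻-rest : d⁻ v rest ≡ 0
      d⁻-rest = n≤0⇒n≡0 (s≤s⁻¹ (begin
        suc (d⁻ v rest)                            ≤⟨ s≤s (m≤n+m _ ⟦ w ≟ v ⟧) ⟩
        suc (⟦ w ≟ v ⟧ + d⁻ v rest)                ≡⟨ cong (_+ (⟦ w ≟ v ⟧ + d⁻ v rest)) (⟦⟧-yes (v ≟ v) refl) ⟨
        ⟦ v ≟ v ⟧ + (⟦ w ≟ v ⟧ + d⁻ v rest)        ≡⟨ decompose _ ⟨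
        d⁻ v G                                     ≡⟨ d⁻≡1 ⟩
        1                                          ∎))
        where open ≤-Reasoning

      d⁺-rest : d⁺ v rest ≡ 0
      d⁺-rest = n≤0⇒n≡0 (s≤s⁻¹ (begin
        suc (d⁺ v rest)                            ≡⟨ cong (_+ d⁺ v rest) (⟦⟧-yes (v ≟ v) refl) ⟨
        ⟦ v ≟ v ⟧ + d⁺ v rest                      ≤⟨ m≤n+m _ ⟦ u ≟ v ⟧ ⟩
        ⟦ u ≟ v ⟧ + (⟦ v ≟ v ⟧ + d⁺ v rest)        ≡⟨ decompose _ ⟨
        d⁺ v G                                     ≡⟨ d⁺≡1 ⟩
        1                                          ∎))
        where open ≤-Reasoning

    avoids : ∀ {a b} → (a , b) ∈ rest → a ≢ v × b ≢ v
    avoids p = (λ { refl → contradiction (subst (0 <_) d⁺-rest (d⁺-positive p)) λ () })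
             , (λ { refl → contradiction (subst (0 <_) d⁻-rest (d⁻-positive p)) λ () })

    contraction : Arcs n
    contraction = (u , w) ∷ rest

    length-contraction : length G ≡ suc (length contraction)
    length-contraction = trans (sym (∑-1 G)) (trans (decompose _) (cong (2 +_) (∑-1 rest)))

    oriented-contraction : (w , u) ∉ rest → Oriented contraction
    oriented-contraction w→u∉ = oriented-∷ u≢w w→u∉ (oriented-⊆ rest-⊆ o)

  opaque
    unfolding d⁺ d⁻

    through : Through
    through with inNeighbour (subst (0 <_) (sym d⁻≡1) z<s)
    ... | u , u→v with ∑-extract u→v
    ... | H , H⊆G , eq with outNeighbour {G = H} {v} (subst (0 <_) (sym d⁺-H) z<s)
      where
      -- Removing `u → v` leaves the out-degree of `v` intact because `u` differs from `v`, so the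
      -- second arc is still found in `H`.
      d⁺-H : d⁺ v H ≡ 1
      d⁺-H = trans (cong (_+ d⁺ v H) (sym (⟦⟧-no (u ≟ v) (distinct o u→v))))
        (trans (sym (eq _)) d⁺≡1)
    ... | w , v→w with ∑-extract v→w
    ... | K , K⊆H , eq′ = record
      { rest = K ; u→v = u→v ; v→w = H⊆G v→w ; rest-⊆ = H⊆G ∘ K⊆H
      ; decompose = λ f → trans (eq f) (cong (f (u , v) +_) (eq′ f)) }

  module _ (T : Through) where
    open Through T

    opaque
      unfolding backward

      -- Strict inequalities survive away from `v`, so no forward arc turns backward there; ties may
      -- be broken either way, as tied arcs were already counted.
      backward-refine : ∀ {r r′ : Fin n → ℕ} {H} → (∀ {e} → e ∈ H → e ∈ rest) →
        (∀ x y → x ≢ v → y ≢ v → r x < r y → r′ x < r′ y) → backward r′ H ≤ backward r H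
      backward-refine {r} {r′} {H} H⊆ mono = ∑-mono H λ {(a , b)} p →
        let a≢v , b≢v = avoids (H⊆ p) in
        ⟦⟧-⇒ (r′ b ≤? r′ a) (r b ≤? r a) λ q → ≮⇒≥ λ a<b → <⇒≱ (mono a b a≢v b≢v a<b) q

      2+2a<1+2b : ∀ {a b} → a < b → suc (suc (2 * a)) < suc (2 * b)
      2+2a<1+2b {a} {b} a<b = s≤s (≤-trans (≤-reflexive (sym (*-suc 2 a))) (*-monoʳ-≤ 2 a<b))

      -- Doubling the ranks makes room for `v` immediately after `u`. Then `u → v` is forward, and
      -- `v → w` is backward only if `u → w` was.
      within-contraction : ∀ {b} → Within contraction b → Within G b
      within-contraction {b} (r , p) = r′ , ≤-trans (*-monoʳ-≤ 3 (begin
        backward r′ G                                          ≡⟨ decompose _ ⟩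
        ⟦ r′ v ≤? r′ u ⟧ + (⟦ r′ w ≤? r′ v ⟧ + backward r′ rest)
          ≤⟨ +-mono-≤ (≤-reflexive (⟦⟧-no (r′ v ≤? r′ u) (<⇒≱ u<v))) (+-mono-≤ (⟦⟧-⇒ (r′ w ≤? r′ v) (r w ≤? r u) w≤v)
               (backward-refine (λ e → e) mono)) ⟩
        backward r contraction                                 ∎)) p
        where
        open ≤-Reasoning
        r′ : Fin n → ℕ
        r′ x with x ≟ v
        ... | yes _ = suc (suc (2 * r u))
        ... | no _  = suc (2 * r x)
        r′-v : r′ v ≡ suc (suc (2 * r u))
        r′-v with v ≟ v
        ... | yes _  = refl
        ... | no v≢v = contradiction refl v≢v
        r′-≢ : ∀ {x} → x ≢ v → r′ x ≡ suc (2 * r x)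
        r′-≢ {x} x≢v with x ≟ v
        ... | yes x≡v = contradiction x≡v x≢v
        ... | no _    = refl
        u<v : r′ u < r′ v
        u<v rewrite r′-v | r′-≢ u≢v = ≤-refl
        w≤v : r′ w ≤ r′ v → r w ≤ r u
        w≤v h rewrite r′-v | r′-≢ w≢v = ≮⇒≥ λ u<w → <⇒≱ (2+2a<1+2b u<w) h
        mono : ∀ x y → x ≢ v → y ≢ v → r x < r y → r′ x < r′ y
        mono x y x≢v y≢v x<y rewrite r′-≢ x≢v | r′-≢ y≢v = <-trans ≤-refl (2+2a<1+2b x<y)

    module _ (w→u : (w , u) ∈ rest) where

      -- Contracting `v` would put `u → w` beside `w → u`, a 2-cycle. Instead one copy of each arc
      -- of the triangle `u → v → w → u` is removed.
      withoutTriangle : Arcs n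
      withoutTriangle = proj₁ (∑-extract w→u)

      decompose-triangle : ∀ f → ∑ f G ≡ f (u , v) + (f (v , w) + (f (w , u) + ∑ f withoutTriangle))
      decompose-triangle f = trans (decompose f)
        (cong (λ s → f (u , v) + (f (v , w) + s)) (proj₂ (proj₂ (∑-extract w→u)) f))

      withoutTriangle-⊆ : ∀ {e} → e ∈ withoutTriangle → e ∈ G
      withoutTriangle-⊆ = rest-⊆ ∘ proj₁ (proj₂ (∑-extract w→u))

      length-triangle : length G ≡ 3 + length withoutTriangle
      length-triangle = trans (sym (∑-1 G)) (trans (decompose-triangle _) (cong (3 +_) (∑-1 withoutTriangle)))

      opaque
        unfolding backward

        -- One backward arc suffices for the triangle. If `u` precedes `w`, then `v` goes between
        -- them and only `w → u` is backward; otherwise `v` goes first and only `u → v` is backward.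
        within-triangle : ∀ {b} → Within withoutTriangle b → Within G (3 + b)
        within-triangle {b} (r , p) with r u <? r w
        ... | yes u<w = r′ , (begin
          3 * backward r′ G                      ≡⟨ cong (3 *_) (decompose-triangle _) ⟩
          3 * (⟦ r′ v ≤? r′ u ⟧ + (⟦ r′ w ≤? r′ v ⟧ + (⟦ r′ u ≤? r′ w ⟧ + backward r′ withoutTriangle)))
            ≤⟨ *-monoʳ-≤ 3 (+-mono-≤ (≤-reflexive (⟦⟧-no (r′ v ≤? r′ u) (<⇒≱ u<v))) (+-mono-≤ (≤-reflexive (⟦⟧-no (r′ w ≤? r′ v) (<⇒≱ v<w)))
                 (+-mono-≤ (⟦⟧≤1 (r′ u ≤? r′ w)) (backward-refine (proj₁ (proj₂ (∑-extract w→u))) mono)))) ⟩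
          3 * suc (backward r withoutTriangle)      ≡⟨ *-suc 3 _ ⟩
          3 + 3 * backward r withoutTriangle        ≤⟨ +-monoʳ-≤ 3 p ⟩
          3 + b                                  ∎)
          where
          open ≤-Reasoning
          r′ : Fin n → ℕ
          r′ x with x ≟ v
          ... | yes _ = suc (suc (2 * r u))
          ... | no _  = suc (2 * r x)
          r′-v : r′ v ≡ suc (suc (2 * r u))
          r′-v with v ≟ v
          ... | yes _  = refl
          ... | no v≢v = contradiction refl v≢v
          r′-≢ : ∀ {x} → x ≢ v → r′ x ≡ suc (2 * r x)
          r′-≢ {x} x≢v with x ≟ v
          ... | yes x≡v = contradiction x≡v x≢v
          ... | no _    = refl
          u<v : r′ u < r′ v
          u<v rewrite r′-v | r′-≢ u≢v = ≤-refl
          v<w : r′ v < r′ w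
          v<w rewrite r′-v | r′-≢ w≢v = 2+2a<1+2b u<w
          mono : ∀ x y → x ≢ v → y ≢ v → r x < r y → r′ x < r′ y
          mono x y x≢v y≢v x<y rewrite r′-≢ x≢v | r′-≢ y≢v = <-trans ≤-refl (2+2a<1+2b x<y)
        ... | no u≮w = r′ , (begin
          3 * backward r′ G                      ≡⟨ cong (3 *_) (decompose-triangle _) ⟩
          3 * (⟦ r′ v ≤? r′ u ⟧ + (⟦ r′ w ≤? r′ v ⟧ + (⟦ r′ u ≤? r′ w ⟧ + backward r′ withoutTriangle)))
            ≤⟨ *-monoʳ-≤ 3 (+-mono-≤ (⟦⟧≤1 (r′ v ≤? r′ u)) (+-mono-≤ (≤-reflexive (⟦⟧-no (r′ w ≤? r′ v) (<⇒≱ v<w)))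
                 (+-mono-≤ (≤-reflexive (⟦⟧-no (r′ u ≤? r′ w) (<⇒≱ w<u))) (backward-refine (proj₁ (proj₂ (∑-extract w→u))) mono)))) ⟩
          3 * suc (backward r withoutTriangle)      ≡⟨ *-suc 3 _ ⟩
          3 + 3 * backward r withoutTriangle        ≤⟨ +-monoʳ-≤ 3 p ⟩
          3 + b                                  ∎)
          where
          open ≤-Reasoning
          -- Ties of r between u and w are broken in favour of w.
          r′ : Fin n → ℕ
          r′ x with x ≟ v | x ≟ w
          ... | yes _ | _     = 0
          ... | no _  | yes _ = suc (2 * r x)
          ... | no _  | no _  = suc (suc (2 * r x))
          r′-v : r′ v ≡ 0
          r′-v with v ≟ v | v ≟ w
          ... | yes _  | _ = refl
          ... | no v≢v | _ = contradiction refl v≢v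
          r′-w : r′ w ≡ suc (2 * r w)
          r′-w with w ≟ v | w ≟ w
          ... | yes w≡v | _      = contradiction w≡v w≢v
          ... | no _    | yes _  = refl
          ... | no _    | no w≢w = contradiction refl w≢w
          r′-u : r′ u ≡ suc (suc (2 * r u))
          r′-u with u ≟ v | u ≟ w
          ... | yes u≡v | _       = contradiction u≡v u≢v
          ... | no _    | yes u≡w = contradiction u≡w u≢w
          ... | no _    | no _    = refl
          v<w : r′ v < r′ w
          v<w rewrite r′-v | r′-w = z<s
          w<u : r′ w < r′ u
          w<u rewrite r′-w | r′-u = s≤s (s≤s (*-monoʳ-≤ 2 (≮⇒≥ u≮w)))
          lower : ∀ {x} → x ≢ v → suc (2 * r x) ≤ r′ x
          lower {x} x≢v with x ≟ v | x ≟ w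
          ... | yes x≡v | _     = contradiction x≡v x≢v
          ... | no _    | yes _ = ≤-refl
          ... | no _    | no _  = n≤1+n _
          upper : ∀ x → r′ x ≤ suc (suc (2 * r x))
          upper x with x ≟ v | x ≟ w
          ... | yes _ | _     = z≤n
          ... | no _  | yes _ = n≤1+n _
          ... | no _  | no _  = ≤-refl
          mono : ∀ x y → x ≢ v → y ≢ v → r x < r y → r′ x < r′ y
          mono x y x≢v y≢v x<y = ≤-trans (s≤s (upper x)) (≤-trans (2+2a<1+2b x<y) (lower y≢v))

-- In- and out-degrees at most two

_∈?_ : (e : Fin n × Fin n) (G : Arcs n) → Dec (e ∈ G)
_∈?_ = DecMembership._∈?_ (≡-dec _≟_ _≟_)

-- As the vertices in `vs` are distinct, their indicators sum to at most 1 at each vertex, so the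
-- unit drops add up. Three drops of `dmin` pay for one backward arc.
∑-drop : ∀ {f g : Fin n → ℕ} vs → AllPairs _≢_ vs → (∀ x → f x ≤ g x) → All (λ v → f v < g v) vs →
         length vs + ∑ f (allFin n) ≤ ∑ g (allFin n)
∑-drop {n} {f} {g} vs uniq f≤g f<g = begin
  length vs + ∑ f (allFin n)
    ≡⟨ cong (_+ ∑ f (allFin n)) (trans (∑-cong vs λ {v} _ → ∑-δ v) (∑-1 vs)) ⟨
  ∑ (λ v → ∑ (λ x → ⟦ v ≟ x ⟧) (allFin n)) vs + ∑ f (allFin n)
    ≡⟨ cong (_+ ∑ f (allFin n)) (∑-swap (λ v x → ⟦ v ≟ x ⟧) vs (allFin n)) ⟩
  ∑ (λ x → ∑ (λ v → ⟦ v ≟ x ⟧) vs) (allFin n) + ∑ f (allFin n)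
    ≡⟨ ∑-+ _ f (allFin n) ⟨
  ∑ (λ x → ∑ (λ v → ⟦ v ≟ x ⟧) vs + f x) (allFin n)
    ≤⟨ ∑-mono (allFin n) (λ {x} _ → pointwise x vs uniq f<g) ⟩
  ∑ g (allFin n) ∎
  where
  open ≤-Reasoning
  absent : ∀ {x} vs → All (x ≢_) vs → ∑ (λ v → ⟦ v ≟ x ⟧) vs ≡ 0
  absent []       []         = refl
  absent {x} (v ∷ vs) (x≢v ∷ x≢vs) = cong₂ _+_ (⟦⟧-no (v ≟ x) (≢-sym x≢v)) (absent vs x≢vs)
  pointwise : ∀ x vs → AllPairs _≢_ vs → All (λ v → f v < g v) vs → ∑ (λ v → ⟦ v ≟ x ⟧) vs + f x ≤ g x
  pointwise x []       []               []             = f≤g x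
  pointwise x (v ∷ vs) (v≢vs ∷ uniq) (fv<gv ∷ f<g) with v ≟ x
  ... | yes refl = ≤-trans (≤-reflexive (cong (λ k → suc (k + f x)) (absent vs v≢vs))) fv<gv
  ... | no _     = pointwise x vs uniq f<g

dmin : Fin n → Arcs n → ℕ
dmin x G = d⁺ x G ⊓ d⁻ x G

weight : Arcs n → ℕ
weight {n} G = ∑ (λ x → dmin x G) (allFin n)

Sparse : Arcs n → Set
Sparse G = ∀ x → d⁺ x G ≤ 2 × d⁻ x G ≤ 2

weight-op : (G : Arcs n) → weight (op G) ≡ weight G
weight-op {n} G = ∑-cong (allFin n) λ {x} _ → trans (cong₂ _⊓_ (d⁺-op x G) (d⁻-op x G)) (⊓-comm (d⁻ x G) (d⁺ x G))

sparse-op : {G : Arcs n} → Sparse G → Sparse (op G)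
sparse-op {G = G} s x = subst (_≤ 2) (sym (d⁺-op x G)) (proj₂ (s x)) , subst (_≤ 2) (sym (d⁻-op x G)) (proj₁ (s x))

weight≤length : (G : Arcs n) → weight G ≤ length G
weight≤length {n} G = ≤-trans (∑-mono (allFin n) λ {x} _ → m⊓n≤m (d⁺ x G) (d⁻ x G)) (≤-reflexive (∑-d⁺ {G = G}))

module _ {G : Arcs n} where

  opaque
    unfolding d⁺ d⁻

    d⁺-∖-≤ : ∀ x v → d⁺ x (G ∖ v) ≤ d⁺ x G
    d⁺-∖-≤ x v = ∑-∖-≤ {G = G} _ v

    d⁻-∖-≤ : ∀ x v → d⁻ x (G ∖ v) ≤ d⁻ x G
    d⁻-∖-≤ x v = ∑-∖-≤ {G = G} _ v

  sparse-∖ : ∀ v → Sparse G → Sparse (G ∖ v)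
  sparse-∖ v s x = ≤-trans (d⁺-∖-≤ x v) (proj₁ (s x)) , ≤-trans (d⁻-∖-≤ x v) (proj₂ (s x))

  dmin-∖-≤ : ∀ x v → dmin x (G ∖ v) ≤ dmin x G
  dmin-∖-≤ x v = ⊓-mono-≤ (d⁺-∖-≤ x v) (d⁻-∖-≤ x v)

  dmin-∖-self : ∀ v → dmin v (G ∖ v) ≡ 0
  dmin-∖-self v = cong (_⊓ d⁻ v (G ∖ v)) (d⁺-∖-self {G = G} v)

  weight-∖-≤ : ∀ v → weight (G ∖ v) ≤ weight G
  weight-∖-≤ v = ∑-mono (allFin n) λ {x} _ → dmin-∖-≤ x v

  length-∖-< : Oriented G → ∀ {v} → 0 < d⁺ v G + d⁻ v G → length (G ∖ v) < length G
  length-∖-< o {v} p = ≤-trans (m<m+n _ p) (≤-reflexive (sym (length-∖ o v)))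

  -- When the out-degree of `x` attains the minimum, losing an out-arc lowers the minimum;
  -- `dmin-∖-out` is the dual.
  dmin-∖-in : Oriented G → ∀ {x v} → (x , v) ∈ G → d⁺ x G ≤ d⁻ x G → dmin x (G ∖ v) < dmin x G
  dmin-∖-in o {x} {v} p le = begin-strict
    dmin x (G ∖ v)              ≤⟨ m⊓n≤m (d⁺ x (G ∖ v)) (d⁻ x (G ∖ v)) ⟩
    d⁺ x (G ∖ v)                <⟨ m<m+n _ (mult-positive p) ⟩
    d⁺ x (G ∖ v) + mult x v G   ≡⟨ d⁺-∖ {G = G} (distinct o p) ⟨
    d⁺ x G                      ≡⟨ m≤n⇒m⊓n≡m le ⟨
    dmin x G                    ∎
    where open ≤-Reasoning

  dmin-∖-out : Oriented G → ∀ {x v} → (v , x) ∈ G → d⁻ x G ≤ d⁺ x G → dmin x (G ∖ v) < dmin x G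
  dmin-∖-out o {x} {v} p le = begin-strict
    dmin x (G ∖ v)              ≤⟨ m⊓n≤n (d⁺ x (G ∖ v)) (d⁻ x (G ∖ v)) ⟩
    d⁻ x (G ∖ v)                <⟨ m<m+n _ (mult-positive p) ⟩
    d⁻ x (G ∖ v) + mult v x G   ≡⟨ d⁻-∖ {G = G} (≢-sym (distinct o p)) ⟨
    d⁻ x G                      ≡⟨ m≥n⇒m⊓n≡n le ⟨
    dmin x G                    ∎
    where open ≤-Reasoning

  -- Each arc at `v` lies, at its other end, on the side where the minimum is attained, so each
  -- neighbour loses its full multiplicity with `v`. Summed over all vertices these multiplicities
  -- give the two degrees of `v`.
  weight-∖-full : Oriented G → ∀ v →
    (∀ {x} → (x , v) ∈ G → d⁺ x G ≤ d⁻ x G) → (∀ {x} → (v , x) ∈ G → d⁻ x G ≤ d⁺ x G) →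
    dmin v G + (d⁻ v G + d⁺ v G) + weight (G ∖ v) ≤ weight G
  weight-∖-full o v ins outs = begin
    dmin v G + (d⁻ v G + d⁺ v G) + weight (G ∖ v)
      ≡⟨ cong (_+ weight (G ∖ v)) (cong₂ _+_ (sym own)
           (cong₂ _+_ (sym (∑-mult-in {G = G} v)) (sym (∑-mult-out {G = G} v)))) ⟩
    ∑ (λ x → ⟦ v ≟ x ⟧ * dmin v G) V + (∑ (λ x → mult x v G) V + ∑ (λ x → mult v x G) V) + weight (G ∖ v)
      ≡⟨ cong (λ s → ∑ (λ x → ⟦ v ≟ x ⟧ * dmin v G) V + s + weight (G ∖ v)) (∑-+ (λ x → mult x v G) _ V) ⟨
    ∑ (λ x → ⟦ v ≟ x ⟧ * dmin v G) V + ∑ (λ x → mult x v G + mult v x G) V + weight (G ∖ v)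
      ≡⟨ cong (_+ weight (G ∖ v)) (∑-+ (λ x → ⟦ v ≟ x ⟧ * dmin v G) _ V) ⟨
    ∑ (λ x → ⟦ v ≟ x ⟧ * dmin v G + (mult x v G + mult v x G)) V + weight (G ∖ v)
      ≡⟨ ∑-+ (λ x → ⟦ v ≟ x ⟧ * dmin v G + (mult x v G + mult v x G)) _ V ⟨
    ∑ (λ x → ⟦ v ≟ x ⟧ * dmin v G + (mult x v G + mult v x G) + dmin x (G ∖ v)) V
      ≤⟨ ∑-mono V (λ {x} _ → pointwise x) ⟩
    weight G ∎
    where
    open ≤-Reasoning
    V = allFin n
    own : ∑ (λ x → ⟦ v ≟ x ⟧ * dmin v G) V ≡ dmin v G
    own = trans (∑-*ʳ (λ x → ⟦ v ≟ x ⟧) (dmin v G) V) (trans (cong (_* dmin v G) (∑-δ v)) (*-identityˡ _))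
    pointwise : ∀ x → ⟦ v ≟ x ⟧ * dmin v G + (mult x v G + mult v x G) + dmin x (G ∖ v) ≤ dmin x G
    pointwise x with v ≟ x
    ... | yes refl rewrite mult-zero {G = G} (λ p → o {v} {v} p p) | dmin-∖-self v = ≤-reflexive (simplify (dmin v G))
      where
      simplify : ∀ a → a + 0 + 0 + 0 ≡ a
      simplify = solve-∀
    ... | no v≢x with (x , v) ∈? G | (v , x) ∈? G
    ... | yes p | _ rewrite mult-zero {G = G} (o p) | m≤n⇒m⊓n≡m (ins p) | +-identityʳ (mult x v G) = begin
      mult x v G + dmin x (G ∖ v)   ≤⟨ +-monoʳ-≤ (mult x v G) (m⊓n≤m (d⁺ x (G ∖ v)) (d⁻ x (G ∖ v))) ⟩
      mult x v G + d⁺ x (G ∖ v)     ≡⟨ +-comm (mult x v G) _ ⟩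
      d⁺ x (G ∖ v) + mult x v G     ≡⟨ d⁺-∖ {G = G} (≢-sym v≢x) ⟨
      d⁺ x G                        ∎
    ... | no _ | yes p rewrite mult-zero {G = G} (o p) | m≥n⇒m⊓n≡n (outs p) = begin
      mult v x G + dmin x (G ∖ v)   ≤⟨ +-monoʳ-≤ (mult v x G) (m⊓n≤n (d⁺ x (G ∖ v)) (d⁻ x (G ∖ v))) ⟩
      mult v x G + d⁻ x (G ∖ v)     ≡⟨ +-comm (mult v x G) _ ⟩
      d⁻ x (G ∖ v) + mult v x G     ≡⟨ d⁻-∖ {G = G} (≢-sym v≢x) ⟨
      d⁻ x G                        ∎
    ... | no p | no q rewrite mult-zero {G = G} p | mult-zero {G = G} q = dmin-∖-≤ x v

  module _ {v} (o : Oriented G) (d⁻≡1 : d⁻ v G ≡ 1) (d⁺≡1 : d⁺ v G ≡ 1) (T : Through o d⁻≡1 d⁺≡1) where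
    open Through T

    opaque
      unfolding d⁺ d⁻

      d⁺-contraction : ∀ x → d⁺ x G ≡ ⟦ v ≟ x ⟧ + d⁺ x contraction
      d⁺-contraction x = trans (decompose _) (exchange ⟦ u ≟ x ⟧ ⟦ v ≟ x ⟧ (d⁺ x rest))
        where
        exchange : ∀ a b c → a + (b + c) ≡ b + (a + c)
        exchange = solve-∀

      d⁻-contraction : ∀ x → d⁻ x G ≡ ⟦ v ≟ x ⟧ + d⁻ x contraction
      d⁻-contraction x = decompose _

    -- The arc `u → w` replaces an out-arc of `u` and an in-arc of `w`, so only `v` changes its
    -- degrees, both from 1 to 0.
    weight-contraction : weight G ≡ suc (weight contraction)
    weight-contraction = trans (∑-cong (allFin n) λ {x} _ →
        trans (cong₂ _⊓_ (d⁺-contraction x) (d⁻-contraction x)) (sym (+-distribˡ-⊓ ⟦ v ≟ x ⟧ _ _)))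
      (trans (∑-+ (λ x → ⟦ v ≟ x ⟧) _ (allFin n)) (cong (_+ weight contraction) (∑-δ v)))

    module _ (w→u : (w , u) ∈ rest) where

      private
        H : Arcs n
        H = withoutTriangle o d⁻≡1 d⁺≡1 T w→u
        on-triangle : Fin n → ℕ
        on-triangle x = ⟦ u ≟ x ⟧ + (⟦ v ≟ x ⟧ + ⟦ w ≟ x ⟧)

      opaque
        unfolding d⁺ d⁻

        d⁺-triangle : ∀ x → d⁺ x G ≡ ⟦ u ≟ x ⟧ + (⟦ v ≟ x ⟧ + ⟦ w ≟ x ⟧) + d⁺ x H
        d⁺-triangle x = trans (decompose-triangle o d⁻≡1 d⁺≡1 T w→u _) (regroup ⟦ u ≟ x ⟧ ⟦ v ≟ x ⟧ ⟦ w ≟ x ⟧ (d⁺ x H))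
          where
          regroup : ∀ a b c d → a + (b + (c + d)) ≡ a + (b + c) + d
          regroup = solve-∀

        d⁻-triangle : ∀ x → d⁻ x G ≡ ⟦ u ≟ x ⟧ + (⟦ v ≟ x ⟧ + ⟦ w ≟ x ⟧) + d⁻ x H
        d⁻-triangle x = trans (decompose-triangle o d⁻≡1 d⁺≡1 T w→u _) (regroup ⟦ u ≟ x ⟧ ⟦ v ≟ x ⟧ ⟦ w ≟ x ⟧ (d⁻ x H))
          where
          regroup : ∀ a b c d → b + (c + (a + d)) ≡ a + (b + c) + d
          regroup = solve-∀

      -- Each vertex of the triangle loses one in-arc and one out-arc, so its minimum falls by
      -- exactly 1. The total of 3 pays for the backward arc of `within-triangle`.
      weight-triangle : weight G ≡ 3 + weight H
      weight-triangle = trans (∑-cong (allFin n) λ {x} _ →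
          trans (cong₂ _⊓_ (d⁺-triangle x) (d⁻-triangle x)) (sym (+-distribˡ-⊓ (on-triangle x) _ _)))
        (trans (∑-+ on-triangle _ (allFin n)) (cong (_+ weight H)
          (trans (∑-+ (λ x → ⟦ u ≟ x ⟧) _ (allFin n)) (cong₂ _+_ (∑-δ u)
            (trans (∑-+ (λ x → ⟦ v ≟ x ⟧) _ (allFin n)) (cong₂ _+_ (∑-δ v) (∑-δ w)))))))

WithinWeight : Arcs n → Set
WithinWeight G = Oriented G → Sparse G → Within G (weight G)

-- Moves for in- and out-degrees at most two.

module SparseStep {G : Arcs n} (o : Oriented G) (s : Sparse G)
                  (ih : ∀ (H : Arcs n) → length H < length G → WithinWeight H) where

  Source-or-sink Pass Up Down Even : Fin n → Set
  Source-or-sink v = 0 < d⁺ v G + d⁻ v G × dmin v G ≡ 0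
  Pass v = d⁻ v G ≡ 1 × d⁺ v G ≡ 1
  Up   v = d⁻ v G ≡ 1 × d⁺ v G ≡ 2
  Down v = d⁻ v G ≡ 2 × d⁺ v G ≡ 1
  Even v = d⁻ v G ≡ 2 × d⁺ v G ≡ 2

  -- Deleting v (Tight), u and v (UpPath) or v and y (DownPath) lowers dmin at all three vertices.
  Tight UpPath DownPath : Fin n → Fin n → Fin n → Set
  Tight u v y = ((u , v) ∈ G × (v , y) ∈ G) × dmin v G ≡ 1 × d⁺ u G ≤ d⁻ u G × d⁻ y G ≤ d⁺ y G
  UpPath u v y = ((u , v) ∈ G × (v , y) ∈ G) × Up u × Up v × Up y
  DownPath u v y = ((u , v) ∈ G × (v , y) ∈ G) × Down u × Down v × Down y

  source-or-sink : ∀ {v} → Source-or-sink v → Within G (weight G)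
  source-or-sink {v} (0<d , dmin≡0) = within-insert v
    (ih (G ∖ v) (length-∖-< o 0<d) (oriented-∖ v o) (sparse-∖ v s))
    (subst (λ k → 3 * k + weight (G ∖ v) ≤ weight G) (sym dmin≡0) (weight-∖-≤ v))

  pass : ∀ {v} → Pass v → Within G (weight G)
  pass (d⁻≡1 , d⁺≡1) = split (through o d⁻≡1 d⁺≡1)
    where
    split : Through o d⁻≡1 d⁺≡1 → Within G (weight G)
    split T = case (w , u) ∈? rest of λ where
        (yes w→u) → subst (Within G) (sym (weight-triangle o d⁻≡1 d⁺≡1 T w→u))
          (within-triangle o d⁻≡1 d⁺≡1 T w→u
            (ih (withoutTriangle o d⁻≡1 d⁺≡1 T w→u)
              (subst (length (withoutTriangle o d⁻≡1 d⁺≡1 T w→u) <_) (sym (length-triangle o d⁻≡1 d⁺≡1 T w→u)) (m<n+m _ z<s))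
              (oriented-⊆ (withoutTriangle-⊆ o d⁻≡1 d⁺≡1 T w→u) o)
              λ x → ≤-trans (≤-trans (m≤n+m _ _) (≤-reflexive (sym (d⁺-triangle o d⁻≡1 d⁺≡1 T w→u x)))) (proj₁ (s x))
                  , ≤-trans (≤-trans (m≤n+m _ _) (≤-reflexive (sym (d⁻-triangle o d⁻≡1 d⁺≡1 T w→u x)))) (proj₂ (s x))))
        (no ¬w→u) → weaken
          (within-contraction o d⁻≡1 d⁺≡1 T
            (ih contraction (≤-reflexive (sym length-contraction)) (oriented-contraction ¬w→u)
              λ x → ≤-trans (≤-trans (m≤n+m _ _) (≤-reflexive (sym (d⁺-contraction o d⁻≡1 d⁺≡1 T x)))) (proj₁ (s x))
                  , ≤-trans (≤-trans (m≤n+m _ _) (≤-reflexive (sym (d⁻-contraction o d⁻≡1 d⁺≡1 T x)))) (proj₂ (s x))))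
          (≤-trans (n≤1+n _) (≤-reflexive (sym (weight-contraction o d⁻≡1 d⁺≡1 T))))
      where open Through T

  ih-∖ : ∀ {v} → 0 < d⁺ v G → Within (G ∖ v) (weight (G ∖ v))
  ih-∖ {v} p = ih (G ∖ v) (length-∖-< o (≤-trans p (m≤m+n _ _))) (oriented-∖ v o) (sparse-∖ v s)

  -- The one backward arc is paid by `u`, which loses an out-arc, by `y`, which loses an in-arc, and
  -- by `v`, which becomes isolated.
  tight : ∀ {u v y} → Tight u v y → Within G (weight G)
  tight {u} {v} {y} ((u→v , v→y) , dmin≡1 , le , ge) = within-insert v (ih-∖ (d⁺-positive v→y))
    (subst (λ k → 3 * k + weight (G ∖ v) ≤ weight G) (sym dmin≡1)
      (∑-drop (u ∷ v ∷ y ∷ [])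
        ((distinct o u→v ∷ (λ { refl → o u→v v→y }) ∷ []) ∷ (distinct o v→y ∷ []) ∷ [] ∷ [])
        (λ x → dmin-∖-≤ x v)
        (dmin-∖-in o u→v le ∷ subst₂ _<_ (sym (dmin-∖-self v)) (sym dmin≡1) z<s ∷ dmin-∖-out o v→y ge ∷ [])))

  -- Deleting `u` costs one backward arc and removes the only arc into `v`. Then `v` is a source and
  -- is deleted for free, which in turn leaves `y` without in-arcs, so all three contributions
  -- vanish.
  upPath : ∀ {u v y} → UpPath u v y → Within G (weight G)
  upPath {u} {v} {y} ((u→v , v→y) , (d⁻u , d⁺u) , (d⁻v , d⁺v) , (d⁻y , d⁺y)) =
    within-insert u within-G₁ (subst (λ k → 3 * k + (weight (G ∖ u ∖ v)) ≤ weight G) (sym (cong₂ _⊓_ d⁺u d⁻u))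
      (∑-drop (u ∷ v ∷ y ∷ [])
        ((distinct o u→v ∷ u≢y ∷ []) ∷ (distinct o v→y ∷ []) ∷ [] ∷ [])
        (λ x → ≤-trans (dmin-∖-≤ x v) (dmin-∖-≤ x u))
        (vanish d⁺u d⁻u (≤-trans (dmin-∖-≤ u v) (≤-reflexive (dmin-∖-self u)))
          ∷ vanish d⁺v d⁻v (≤-reflexive (dmin-∖-self v))
          ∷ vanish d⁺y d⁻y (≤-trans (m⊓n≤n (d⁺ y (G ∖ u ∖ v)) _) (≤-reflexive d⁻y-G₂)) ∷ [])))
    where
    u≢y : u ≢ y
    u≢y refl = o u→v v→y
    d⁻-source : ∀ {H : Arcs n} {a b} → Oriented H → (a , b) ∈ H → d⁻ b H ≤ 1 → d⁻ b (H ∖ a) ≡ 0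
    d⁻-source {H} {a} {b} oH p le = n≤0⇒n≡0 (s≤s⁻¹ (begin-strict
      d⁻ b (H ∖ a)              <⟨ m<m+n _ (mult-positive p) ⟩
      d⁻ b (H ∖ a) + mult a b H ≡⟨ d⁻-∖ {G = H} (≢-sym (distinct oH p)) ⟨
      d⁻ b H                    ≤⟨ le ⟩
      1                         ∎))
      where open ≤-Reasoning
    vanish : ∀ {x k} → d⁺ x G ≡ 2 → d⁻ x G ≡ 1 → k ≤ 0 → k < dmin x G
    vanish p q k≤0 = s≤s (≤-trans k≤0 z≤n) ⟫ cong₂ _⊓_ p q
      where
      _⟫_ : ∀ {a b} → a ≤ 1 → b ≡ 1 → a ≤ b
      a≤1 ⟫ refl = a≤1
    G₁ = G ∖ u
    o₁ : Oriented G₁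
    o₁ = oriented-∖ u o
    d⁻v-G₁ : d⁻ v G₁ ≡ 0
    d⁻v-G₁ = d⁻-source o u→v (≤-reflexive d⁻v)
    v→y-G₁ : (v , y) ∈ G₁
    v→y-G₁ = ∈-∖⁺ v→y (≢-sym (distinct o u→v)) (≢-sym u≢y)
    d⁻y-G₂ : d⁻ y (G₁ ∖ v) ≡ 0
    d⁻y-G₂ = d⁻-source o₁ v→y-G₁ (≤-trans (d⁻-∖-≤ y u) (≤-reflexive d⁻y))
    within-G₁ : Within G₁ (weight (G₁ ∖ v))
    within-G₁ = within-insert v
      (ih (G₁ ∖ v) (<-trans (length-∖-< o₁ (≤-trans (d⁺-positive v→y-G₁) (m≤m+n _ _)))
                            (length-∖-< o (≤-trans (d⁺-positive u→v) (m≤m+n _ _))))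
        (oriented-∖ v o₁) (sparse-∖ v (sparse-∖ u s)))
      (≤-reflexive (cong (λ k → 3 * k + weight (G₁ ∖ v))
        (trans (cong (d⁺ v G₁ ⊓_) d⁻v-G₁) (⊓-zeroʳ (d⁺ v G₁)))))

  delete-even : ∀ {c} → Even c →
    (∀ {x} → (x , c) ∈ G → d⁺ x G ≤ d⁻ x G) → (∀ {x} → (c , x) ∈ G → d⁻ x G ≤ d⁺ x G) → Within G (weight G)
  delete-even {c} (d⁻≡2 , d⁺≡2) ins outs = within-insert c
    (ih-∖ (subst (0 <_) (sym d⁺≡2) z<s))
    (≤-trans (≤-reflexive (cong (_+ weight (G ∖ c)) six)) (weight-∖-full o c ins outs))
    where
    -- Both sides are 6: two backward arcs against 2 for `c` and 1 for each of its four arcs.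
    six : 3 * dmin c G ≡ dmin c G + (d⁻ c G + d⁺ c G)
    six rewrite d⁻≡2 | d⁺≡2 = refl

  -- Deleting v turns y into a vertex of in- and out-degree 1, which is then contracted.
  upDown : ∀ {u v y} → (u , v) ∈ G → (v , y) ∈ G → Up v → Down y → d⁺ u G ≤ d⁻ u G →
    (∀ {r t} → (r , y) ∈ G → (y , t) ∈ G → (t , r) ∉ G) → Within G (weight G)
  upDown {u} {v} {y} u→v v→y (d⁻v , d⁺v) (d⁻y , d⁺y) le noTriangle =
    case d⁻ y G₁ ℕ.≟ 0 of λ where
      -- Both arcs into `y` come from `v`; without them `dmin` vanishes at `y`, which is the third
      -- unit.
      (yes d⁻≡0) → insert (ih-∖ (d⁺-positive v→y))
        (∑-drop (u ∷ v ∷ y ∷ [])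
          ((distinct o u→v ∷ (λ { refl → o u→v v→y }) ∷ []) ∷ (distinct o v→y ∷ []) ∷ [] ∷ [])
          (λ x → dmin-∖-≤ x v)
          (u-drop ∷ v-drop ∷ subst₂ _<_
            (sym (trans (cong (d⁺ y G₁ ⊓_) d⁻≡0) (⊓-zeroʳ (d⁺ y G₁)))) (sym (cong₂ _⊓_ d⁺y d⁻y)) z<s ∷ []))
      (no d⁻≢0) → contract (through o₁ (d⁻y-G₁ d⁻≢0) d⁺y-G₁)
    where
    G₁ = G ∖ v
    o₁ : Oriented G₁
    o₁ = oriented-∖ v o
    y≢v : y ≢ v
    y≢v = ≢-sym (distinct o v→y)
    dmin-v : dmin v G ≡ 1
    dmin-v = cong₂ _⊓_ d⁺v d⁻v
    u-drop : dmin u G₁ < dmin u G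
    u-drop = dmin-∖-in o u→v le
    v-drop : dmin v G₁ < dmin v G
    v-drop = subst₂ _<_ (sym (dmin-∖-self v)) (sym dmin-v) z<s
    insert : ∀ {b} → Within G₁ b → 3 + b ≤ weight G → Within G (weight G)
    insert {b} p q = within-insert v p (subst (λ k → 3 * k + b ≤ weight G) (sym dmin-v) q)
    d⁺y-G₁ : d⁺ y G₁ ≡ 1
    d⁺y-G₁ = begin
      d⁺ y G₁                  ≡⟨ +-identityʳ _ ⟨
      d⁺ y G₁ + 0              ≡⟨ cong (d⁺ y G₁ +_) (mult-zero {G = G} (o v→y)) ⟨
      d⁺ y G₁ + mult y v G     ≡⟨ d⁺-∖ y≢v ⟨
      d⁺ y G                   ≡⟨ d⁺y ⟩
      1                        ∎
      where open ≡-Reasoning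
    d⁻y-G₁ : d⁻ y G₁ ≢ 0 → d⁻ y G₁ ≡ 1
    d⁻y-G₁ d⁻≢0 = ≤-antisym (s≤s⁻¹ (begin-strict
      d⁻ y G₁                  <⟨ m<m+n _ (mult-positive v→y) ⟩
      d⁻ y G₁ + mult v y G     ≡⟨ d⁻-∖ y≢v ⟨
      d⁻ y G                   ≡⟨ d⁻y ⟩
      2                        ∎)) (n≢0⇒n>0 d⁻≢0)
      where open ≤-Reasoning
    -- Deleting `v` lowers the weight at `u` and at `v`, and contracting `y` yields the third unit;
    -- `noTriangle` keeps the contraction free of 2-cycles.
    contract : ∀ {p} → Through o₁ p d⁺y-G₁ → Within G (weight G)
    contract {d⁻≡1} T = insert
      (within-contraction o₁ d⁻≡1 d⁺y-G₁ T
        (ih contraction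
          (<-trans (≤-reflexive (sym length-contraction)) (length-∖-< o (≤-trans (d⁺-positive v→y) (m≤m+n _ _))))
          (oriented-contraction λ w→u → noTriangle (∖-⊆ G v u→v′) (∖-⊆ G v v→w) (∖-⊆ G v (rest-⊆ w→u)))
          λ x → ≤-trans (≤-trans (m≤n+m _ _) (≤-reflexive (sym (d⁺-contraction o₁ d⁻≡1 d⁺y-G₁ T x)))) (proj₁ (sparse-∖ v s x))
              , ≤-trans (≤-trans (m≤n+m _ _) (≤-reflexive (sym (d⁻-contraction o₁ d⁻≡1 d⁺y-G₁ T x)))) (proj₂ (sparse-∖ v s x))))
      (begin
        3 + weight contraction   ≡⟨ cong (2 +_) (weight-contraction o₁ d⁻≡1 d⁺y-G₁ T) ⟨
        2 + weight G₁            ≤⟨ ∑-drop (u ∷ v ∷ []) ((distinct o u→v ∷ []) ∷ [] ∷ [])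
                                      (λ x → dmin-∖-≤ x v) (u-drop ∷ v-drop ∷ []) ⟩
        weight G                 ∎)
      where
      open Through T using (contraction; length-contraction; oriented-contraction; rest-⊆; v→w) renaming (u→v to u→v′)
      open ≤-Reasoning

-- Reversal and the structure of irreducible digraphs.

module SparseCases {G : Arcs n} (o : Oriented G) (s : Sparse G)
                   (ih : ∀ (H : Arcs n) → length H < length G → WithinWeight H) where
  open SparseStep o s ih

  downPath : ∀ {u v y} → DownPath u v y → Within G (weight G)
  downPath {u} {v} {y} ((u→v , v→y) , du , dv , dy) = within-op (subst (Within (op G)) (weight-op G)
    (SparseStep.upPath (oriented-op o) (sparse-op s)
      (λ H lt → ih H (subst (length H <_) (length-map swap G) lt))
      {y} {v} {u} ((∈-map⁺ swap v→y , ∈-map⁺ swap u→v) , flip dy , flip dv , flip du)))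
    where
    flip : ∀ {x} → Down x → d⁻ x (op G) ≡ 1 × d⁺ x (op G) ≡ 2
    flip {x} (d⁻≡2 , d⁺≡1) = trans (d⁻-op x G) d⁺≡1 , trans (d⁺-op x G) d⁻≡2

  module Irreducible
    (¬source-or-sink : ∀ v → ¬ Source-or-sink v) (¬pass : ∀ v → ¬ Pass v)
    (¬tight : ∀ u v y → ¬ Tight u v y)
    (¬upPath : ∀ u v y → ¬ UpPath u v y) (¬downPath : ∀ u v y → ¬ DownPath u v y)
    where

    data Kind (x : Fin n) : Set where
      isolated : d⁻ x G ≡ 0 → d⁺ x G ≡ 0 → Kind x
      up       : Up x → Kind x
      down     : Down x → Kind x
      even     : Even x → Kind x

    kind : ∀ x → Kind x
    kind x with d⁻ x G in p | d⁺ x G in q | proj₂ (s x) | proj₁ (s x)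
    ... | 0 | 0 | _ | _ = isolated p q
    ... | 0 | suc _ | _ | _ = contradiction
      (subst (0 <_) (sym (cong₂ _+_ q p)) z<s , cong₂ _⊓_ q p) (¬source-or-sink x)
    ... | suc _ | 0 | _ | _ = contradiction
      (subst (0 <_) (sym (cong₂ _+_ q p)) z<s , cong₂ _⊓_ q p) (¬source-or-sink x)
    ... | 1 | 1 | _ | _ = contradiction (p , q) (¬pass x)
    ... | 1 | 2 | _ | _ = up (p , q)
    ... | 2 | 1 | _ | _ = down (p , q)
    ... | 2 | 2 | _ | _ = even (p , q)
    ... | _ | suc (suc (suc _)) | _ | s≤s (s≤s ())
    ... | suc (suc (suc _)) | _ | s≤s (s≤s ()) | _

    -- The inequality is what `Tight` and `delete-even` ask of an in-neighbour; up vertices are the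
    -- only obstruction to it. Dually, `down-or-≤` serves for out-neighbours.
    up-or-≤ : ∀ x → Up x ⊎ d⁺ x G ≤ d⁻ x G
    up-or-≤ x with kind x
    ... | isolated p q   = inj₂ (≤-reflexive (trans q (sym p)))
    ... | up u           = inj₁ u
    ... | down (p , q)   = inj₂ (subst₂ _≤_ (sym q) (sym p) (s≤s z≤n))
    ... | even (p , q)   = inj₂ (≤-reflexive (trans q (sym p)))

    down-or-≤ : ∀ x → Down x ⊎ d⁻ x G ≤ d⁺ x G
    down-or-≤ x with kind x
    ... | isolated p q   = inj₂ (≤-reflexive (trans p (sym q)))
    ... | up (p , q)     = inj₂ (subst₂ _≤_ (sym p) (sym q) (s≤s z≤n))
    ... | down d         = inj₁ d
    ... | even (p , q)   = inj₂ (≤-reflexive (trans p (sym q)))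

    up-≤ : ∀ {x} → Up x → d⁻ x G ≤ d⁺ x G
    up-≤ (p , q) = subst₂ _≤_ (sym p) (sym q) (s≤s z≤n)

    down-≤ : ∀ {x} → Down x → d⁺ x G ≤ d⁻ x G
    down-≤ (p , q) = subst₂ _≤_ (sym q) (sym p) (s≤s z≤n)

    predecessor : ∀ {x k} → d⁻ x G ≡ suc k → ∃ λ u → (u , x) ∈ G
    predecessor p = inNeighbour (subst (0 <_) (sym p) z<s)

    successor : ∀ {x k} → d⁺ x G ≡ suc k → ∃ λ y → (x , y) ∈ G
    successor p = outNeighbour (subst (0 <_) (sym p) z<s)

    -- If `y` were not down, an in-neighbour `u` of `x` would be up, else `u`, `x`, `y` is tight; an
    -- in-neighbour `t` of `u` would be up, else `t`, `u`, `x` is tight. Then `t`, `u`, `x` is an up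
    -- path. The dual `up→down⁻` follows a path forwards.
    up→down : ∀ {x y} → Up x → (x , y) ∈ G → Down y
    up→down {x} {y} ux@(d⁻x , d⁺x) x→y with down-or-≤ y
    ... | inj₁ dy = dy
    ... | inj₂ ge with predecessor d⁻x
    ... | u , u→x with up-or-≤ u
    ... | inj₂ le = contradiction ((u→x , x→y) , cong₂ _⊓_ d⁺x d⁻x , le , ge) (¬tight u x y)
    ... | inj₁ uu@(d⁻u , d⁺u) with predecessor d⁻u
    ... | t , t→u with up-or-≤ t
    ... | inj₂ le = contradiction ((t→u , u→x) , cong₂ _⊓_ d⁺u d⁻u , le , up-≤ ux) (¬tight t u x)
    ... | inj₁ ut = contradiction ((t→u , u→x) , ut , uu , ux) (¬upPath t u x)

    up→down⁻ : ∀ {x y} → Down y → (x , y) ∈ G → Up x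
    up→down⁻ {x} {y} dy@(d⁻y , d⁺y) x→y with up-or-≤ x
    ... | inj₁ ux = ux
    ... | inj₂ le with successor d⁺y
    ... | t , y→t with down-or-≤ t
    ... | inj₂ ge = contradiction ((x→y , y→t) , cong₂ _⊓_ d⁺y d⁻y , le , ge) (¬tight x y t)
    ... | inj₁ dt@(d⁻t , d⁺t) with successor d⁺t
    ... | r , t→r with down-or-≤ r
    ... | inj₂ ge = contradiction ((y→t , t→r) , cong₂ _⊓_ d⁺t d⁻t , down-≤ dy , ge) (¬tight y t r)
    ... | inj₁ dr = contradiction ((y→t , t→r) , dy , dt , dr) (¬downPath y t r)

    ¬up∧down : ∀ {x} → Up x → ¬ Down x
    ¬up∧down (p , _) (q , _) = contradiction (trans (sym p) q) λ ()

    -- As `c` is neither down nor up, no in-neighbour of `c` is up and no out-neighbour is down,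
    -- which is what `delete-even` requires.
    even⇒within : ∀ {c} → Even c → Within G (weight G)
    even⇒within {c} ec@(d⁻c , d⁺c) = delete-even ec ins outs
      where
      ins : ∀ {x} → (x , c) ∈ G → d⁺ x G ≤ d⁻ x G
      ins {x} x→c with up-or-≤ x
      ... | inj₂ le = le
      ... | inj₁ ux = contradiction (trans (sym d⁺c) (proj₂ (up→down ux x→c))) λ ()
      outs : ∀ {x} → (c , x) ∈ G → d⁻ x G ≤ d⁺ x G
      outs {x} c→x with down-or-≤ x
      ... | inj₂ ge = ge
      ... | inj₁ dx = contradiction (trans (sym d⁻c) (proj₁ (up→down⁻ dx c→x))) λ ()

    up⇒within : (∀ x → ¬ Even x) → ∀ {v} → Up v → Within G (weight G)
    up⇒within ¬even {v} uv@(d⁻v , d⁺v) with predecessor d⁻v | successor d⁺v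
    ... | u , u→v | y , v→y with up-or-≤ u
    ... | inj₁ uu = contradiction (up→down uu u→v) (¬up∧down uv)
    ... | inj₂ le = upDown u→v v→y uv dy le noTriangle
      where
      dy = up→down uv v→y
      -- Since `y` is down, `r` is up. If `t` were up, `t → r` would make `r` down; if `t` were
      -- down, `y → t` would make `y` up.
      noTriangle : ∀ {r t} → (r , y) ∈ G → (y , t) ∈ G → (t , r) ∉ G
      noTriangle {r} {t} r→y y→t t→r with kind t
      ... | isolated d⁻t _ = contradiction (subst (0 <_) d⁻t (d⁻-positive y→t)) λ ()
      ... | up ut   = ¬up∧down (up→down⁻ dy r→y) (up→down ut t→r)
      ... | down dt = ¬up∧down (up→down⁻ dt y→t) dy
      ... | even et = ¬even t et

    edgeless : (∀ x → ¬ Even x) → (∀ x → ¬ Up x) → ∀ {e} → e ∉ G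
    edgeless ¬even ¬up {x , y} x→y with kind x
    ... | isolated _ d⁺x = contradiction (subst (0 <_) d⁺x (d⁺-positive x→y)) λ ()
    ... | up ux   = ¬up x ux
    ... | even ex = ¬even x ex
    ... | down dx = let r , r→x = predecessor (proj₁ dx) in ¬up r (up→down⁻ dx r→x)

within-edgeless : ∀ {G : Arcs n} {b} → (∀ {e} → e ∉ G) → Within G b
within-edgeless {G = []}    _     = (λ _ → 0) , ≤-trans (≤-reflexive (cong (3 *_) (backward-[] (λ _ → 0)))) z≤n
within-edgeless {G = e ∷ G} empty = contradiction (here refl) (empty {e})

any³? : {P : Fin n → Fin n → Fin n → Set} → (∀ u v w → Dec (P u v w)) → Dec (∃ λ u → ∃ λ v → ∃ λ w → P u v w)
any³? P? = any? λ u → any? λ v → any? λ w → P? u v w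

module _ {G : Arcs n} (o : Oriented G) (s : Sparse G)
         (ih : ∀ (H : Arcs n) → length H < length G → WithinWeight H) where
  open SparseStep o s ih
  open SparseCases o s ih

  private
    degrees? : ∀ i j x → Dec (d⁻ x G ≡ i × d⁺ x G ≡ j)
    degrees? i j x = (d⁻ x G ℕ.≟ i) ×-dec (d⁺ x G ℕ.≟ j)

    path? : ∀ u v y → Dec ((u , v) ∈ G × (v , y) ∈ G)
    path? u v y = ((u , v) ∈? G) ×-dec ((v , y) ∈? G)

    source-or-sink? : ∀ v → Dec (Source-or-sink v)
    source-or-sink? v = (0 <? d⁺ v G + d⁻ v G) ×-dec (dmin v G ℕ.≟ 0)

    tight? : ∀ u v y → Dec (Tight u v y)
    tight? u v y = path? u v y
      ×-dec ((dmin v G ℕ.≟ 1) ×-dec ((d⁺ u G ≤? d⁻ u G) ×-dec (d⁻ y G ≤? d⁺ y G)))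

    upPath? : ∀ u v y → Dec (UpPath u v y)
    upPath? u v y = path? u v y ×-dec (degrees? 1 2 u ×-dec (degrees? 1 2 v ×-dec degrees? 1 2 y))

    downPath? : ∀ u v y → Dec (DownPath u v y)
    downPath? u v y = path? u v y ×-dec (degrees? 2 1 u ×-dec (degrees? 2 1 v ×-dec degrees? 2 1 y))

  sparse-step : Within G (weight G)
  sparse-step with any? source-or-sink?
  ... | yes (_ , p) = source-or-sink p
  ... | no ¬p₁ with any? (degrees? 1 1)
  ... | yes (_ , p) = pass p
  ... | no ¬p₂ with any³? tight?
  ... | yes (_ , _ , _ , p) = tight p
  ... | no ¬p₃ with any³? upPath?
  ... | yes (_ , _ , _ , p) = upPath p
  ... | no ¬p₄ with any³? downPath?
  ... | yes (_ , _ , _ , p) = downPath p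
  ... | no ¬p₅ = irreducible (any? (degrees? 2 2)) (any? (degrees? 1 2))
    where
    open Irreducible (λ v p → ¬p₁ (v , p)) (λ v p → ¬p₂ (v , p)) (λ u v y p → ¬p₃ (u , v , y , p))
                     (λ u v y p → ¬p₄ (u , v , y , p)) (λ u v y p → ¬p₅ (u , v , y , p))
    irreducible : Dec (∃ Even) → Dec (∃ Up) → Within G (weight G)
    irreducible (yes (_ , e)) _             = even⇒within e
    irreducible (no ¬e)       (yes (_ , u)) = up⇒within (λ x e → ¬e (x , e)) u
    irreducible (no ¬e)       (no ¬u)       = within-edgeless (edgeless (λ x e → ¬e (x , e)) (λ x u → ¬u (x , u)))

within-weight : (G : Arcs n) → WithinWeight G
within-weight G = go G (<-wellFounded (length G))
  where
  go : ∀ G → Acc _<_ (length G) → WithinWeight G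
  go G (acc rs) o s = sparse-step o s (λ H H<G → go H (rs H<G))

-- Degrees at most five

deg : Fin n → Arcs n → ℕ
deg x G = d⁺ x G + d⁻ x G

MaxDegree≤5 : Arcs n → Set
MaxDegree≤5 G = ∀ x → deg x G ≤ 5

-- The strict inequality expresses the bound m - 1 without subtraction.
Slack : Arcs n → Set
Slack G = ∃ λ b → b < length G × Within G b

-- The second component is the strengthening that pays for deleting a vertex of type (2, 3).
WithinLength : Arcs n → Set
WithinLength G = Oriented G → MaxDegree≤5 G →
  Within G (length G) × (∀ v → deg v G ≡ 3 → Slack G)

deg-op : ∀ x (G : Arcs n) → deg x (op G) ≡ deg x G
deg-op x G = trans (cong₂ _+_ (d⁺-op x G) (d⁻-op x G)) (+-comm (d⁻ x G) (d⁺ x G))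

deg-∖-≤ : ∀ {G : Arcs n} x v → deg x (G ∖ v) ≤ deg x G
deg-∖-≤ x v = +-mono-≤ (d⁺-∖-≤ x v) (d⁻-∖-≤ x v)

-- Here `i` is the out-degree and `j` the in-degree. `cheap` says that the deleted arcs cover the
-- cost of insertion; for a total of at most 5 this fails only at (1, 1), (2, 2), (2, 3) and (3, 2).
data DegreeKind (i j : ℕ) : Set where
  cheap : 3 * (i ⊓ j) ≤ i + j → DegreeKind i j
  pass  : j ≡ 1 → i ≡ 1 → DegreeKind i j
  even  : j ≡ 2 → i ≡ 2 → DegreeKind i j
  2-in  : j ≡ 2 → i ≡ 3 → DegreeKind i j
  2-out : j ≡ 3 → i ≡ 2 → DegreeKind i j

degreeKind : ∀ i j → i + j ≤ 5 → DegreeKind i j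
degreeKind 0 j _ = cheap z≤n
degreeKind (suc i) 0 _ = cheap z≤n
degreeKind 1 1 _ = pass refl refl
degreeKind 1 (suc (suc j)) _ = cheap (s≤s (s≤s (s≤s z≤n)))
degreeKind (suc (suc i)) 1 _ = cheap (s≤s (s≤s (m≤n+m 1 i)))
degreeKind 2 2 _ = even refl refl
degreeKind 2 3 _ = 2-out refl refl
degreeKind 3 2 _ = 2-in refl refl
degreeKind 2 (suc (suc (suc (suc _)))) (s≤s (s≤s (s≤s (s≤s (s≤s ())))))
degreeKind 3 (suc (suc (suc _))) (s≤s (s≤s (s≤s (s≤s (s≤s ())))))
degreeKind (suc (suc (suc (suc i)))) (suc (suc j)) (s≤s (s≤s (s≤s (s≤s h)))) =
  contradiction (≤-trans (m≤n+m _ i) h) λ { (s≤s ()) }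

-- The summand 2 stands for the two arcs left at the sink `c` in `slack-2-1`. Only (2, 2) violates
-- the inequality, with 6 on both sides.
3*⊓<2+ : ∀ i j → i + j ≤ 5 → i + j ≢ 4 → 3 * (i ⊓ j) < 2 + (i + j)
3*⊓<2+ 0 j _ _ = z<s
3*⊓<2+ (suc i) 0 _ _ = z<s
3*⊓<2+ 1 (suc j) _ _ = s≤s (s≤s (s≤s (s≤s z≤n)))
3*⊓<2+ (suc (suc i)) 1 _ _ = s≤s (s≤s (s≤s (s≤s z≤n)))
3*⊓<2+ 2 2 _ ≢4 = contradiction refl ≢4
3*⊓<2+ 2 3 _ _ = ≤-refl
3*⊓<2+ 3 2 _ _ = ≤-refl
3*⊓<2+ 2 (suc (suc (suc (suc _)))) (s≤s (s≤s (s≤s (s≤s (s≤s ()))))) _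
3*⊓<2+ 3 (suc (suc (suc _))) (s≤s (s≤s (s≤s (s≤s (s≤s ()))))) _
3*⊓<2+ (suc (suc (suc (suc i)))) (suc (suc j)) (s≤s (s≤s (s≤s (s≤s h)))) _ =
  contradiction (≤-trans (m≤n+m _ i) h) λ { (s≤s ()) }

module _ {G : Arcs n} (o : Oriented G) {u v : Fin n} (u→v : (u , v) ∈ G) where

  d⁺-∖-tail : d⁺ u G ≡ d⁺ u (G ∖ v) + mult u v G
  d⁺-∖-tail = d⁺-∖ (distinct o u→v)

  d⁻-∖-tail : d⁻ u (G ∖ v) ≡ d⁻ u G
  d⁻-∖-tail = sym (trans (d⁻-∖ (distinct o u→v))
    (trans (cong (d⁻ u (G ∖ v) +_) (mult-zero (o u→v))) (+-identityʳ _)))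

  d⁻-∖-head : d⁻ v G ≡ d⁻ v (G ∖ u) + mult u v G
  d⁻-∖-head = d⁻-∖ (≢-sym (distinct o u→v))

  d⁺-∖-head : d⁺ v (G ∖ u) ≡ d⁺ v G
  d⁺-∖-head = sym (trans (d⁺-∖ (≢-sym (distinct o u→v)))
    (trans (cong (d⁺ v (G ∖ u) +_) (mult-zero (o u→v))) (+-identityʳ _)))

module LengthStep {G : Arcs n} (o : Oriented G) (Δ≤5 : MaxDegree≤5 G)
                  (ih : ∀ (H : Arcs n) → length H < length G → WithinLength H) where

  ih-∖ : ∀ {v} → 0 < deg v G →
         Within (G ∖ v) (length (G ∖ v)) × (∀ x → deg x (G ∖ v) ≡ 3 → Slack (G ∖ v))
  ih-∖ {v} 0<d = ih (G ∖ v) (length-∖-< o 0<d) (oriented-∖ v o) (λ x → ≤-trans (deg-∖-≤ x v) (Δ≤5 x))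

  ih-⊆ : ∀ H → length H < length G → Oriented H → (∀ x → d⁺ x H ≤ d⁺ x G × d⁻ x H ≤ d⁻ x G) →
         Within H (length H)
  ih-⊆ H lt oH le = proj₁ (ih H lt oH λ x → ≤-trans (+-mono-≤ (proj₁ (le x)) (proj₂ (le x))) (Δ≤5 x))

  delete-cheap : ∀ {v} → 0 < deg v G → 3 * dmin v G ≤ deg v G → Within G (length G)
  delete-cheap {v} 0<d h = within-insert v (proj₁ (ih-∖ 0<d)) (begin
    3 * dmin v G + length (G ∖ v)   ≤⟨ +-monoˡ-≤ _ h ⟩
    deg v G + length (G ∖ v)        ≡⟨ +-comm (deg v G) _ ⟩
    length (G ∖ v) + deg v G        ≡⟨ length-∖ o v ⟨
    length G                        ∎)
    where open ≤-Reasoning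

  -- Contraction loses an arc at no cost, and removing a triangle loses three arcs for one backward
  -- arc. Neither raises a degree, so the bound 5 persists.
  contract-pass : ∀ {v} → d⁻ v G ≡ 1 → d⁺ v G ≡ 1 → Within G (length G)
  contract-pass {v} d⁻≡1 d⁺≡1 = split (through o d⁻≡1 d⁺≡1)
    where
    split : Through o d⁻≡1 d⁺≡1 → Within G (length G)
    split T = case (w , u) ∈? rest of λ where
        (yes w→u) → subst (Within G) (sym (length-triangle o d⁻≡1 d⁺≡1 T w→u))
          (within-triangle o d⁻≡1 d⁺≡1 T w→u
            (ih-⊆ (withoutTriangle o d⁻≡1 d⁺≡1 T w→u)
              (≤-trans (m<n+m _ (z<s {2})) (≤-reflexive (sym (length-triangle o d⁻≡1 d⁺≡1 T w→u))))
              (oriented-⊆ (withoutTriangle-⊆ o d⁻≡1 d⁺≡1 T w→u) o)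
              λ x → ≤-trans (m≤n+m _ _) (≤-reflexive (sym (d⁺-triangle o d⁻≡1 d⁺≡1 T w→u x)))
                  , ≤-trans (m≤n+m _ _) (≤-reflexive (sym (d⁻-triangle o d⁻≡1 d⁺≡1 T w→u x)))))
        (no ¬w→u) → weaken
          (within-contraction o d⁻≡1 d⁺≡1 T
            (ih-⊆ contraction (≤-reflexive (sym length-contraction)) (oriented-contraction ¬w→u)
              λ x → ≤-trans (m≤n+m _ _) (≤-reflexive (sym (d⁺-contraction o d⁻≡1 d⁺≡1 T x)))
                  , ≤-trans (m≤n+m _ _) (≤-reflexive (sym (d⁻-contraction o d⁻≡1 d⁺≡1 T x)))))
          (≤-trans (n≤1+n _) (≤-reflexive (sym length-contraction)))
      where open Through T

  delete₂ : ∀ x y → 0 < deg x G → Within G (3 * dmin x G + (3 * dmin y (G ∖ x) + length (G ∖ x ∖ y)))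
  delete₂ x y 0<d = within-insert x (within-insert y
      (ih-⊆ (G ∖ x ∖ y) (≤-<-trans (≤-trans (m≤m+n _ _) (≤-reflexive (sym (length-∖ (oriented-∖ x o) y))))
                                   (length-∖-< o 0<d))
        (oriented-∖ y (oriented-∖ x o))
        λ z → ≤-trans (d⁺-∖-≤ z y) (d⁺-∖-≤ z x) , ≤-trans (d⁻-∖-≤ z y) (d⁻-∖-≤ z x))
      ≤-refl) ≤-refl

  length-∖₂ : ∀ x y → length G ≡ deg x G + (deg y (G ∖ x) + length (G ∖ x ∖ y))
  length-∖₂ x y = begin
    length G                                               ≡⟨ length-∖ o x ⟩
    length (G ∖ x) + deg x G                               ≡⟨ +-comm _ (deg x G) ⟩
    deg x G + length (G ∖ x)                               ≡⟨ cong (deg x G +_) (length-∖ (oriented-∖ x o) y) ⟩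
    deg x G + (length (G ∖ x ∖ y) + deg y (G ∖ x))         ≡⟨ cong (deg x G +_) (+-comm _ (deg y (G ∖ x))) ⟩
    deg x G + (deg y (G ∖ x) + length (G ∖ x ∖ y))         ∎
    where open ≡-Reasoning

  delete₂-cheap : ∀ x y → 0 < deg x G → 3 * dmin x G + 3 * dmin y (G ∖ x) ≤ deg x G + deg y (G ∖ x) →
                  Within G (length G)
  delete₂-cheap x y 0<d h = weaken (delete₂ x y 0<d) (begin
    3 * dmin x G + (3 * dmin y (G ∖ x) + ℓ)    ≡⟨ +-assoc (3 * dmin x G) _ ℓ ⟨
    3 * dmin x G + 3 * dmin y (G ∖ x) + ℓ      ≤⟨ +-monoˡ-≤ ℓ h ⟩
    deg x G + deg y (G ∖ x) + ℓ                ≡⟨ +-assoc (deg x G) _ ℓ ⟩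
    deg x G + (deg y (G ∖ x) + ℓ)              ≡⟨ length-∖₂ x y ⟨
    length G                                   ∎)
    where
    open ≤-Reasoning
    ℓ = length (G ∖ x ∖ y)

  slack-2-1 : ∀ {c} → d⁻ c G ≡ 2 → d⁺ c G ≡ 1 → Slack G
  slack-2-1 {c} d⁻c d⁺c with outNeighbour {G = G} {c} (subst (0 <_) (sym d⁺c) z<s)
  ... | x , c→x with deg x G ℕ.≟ 4
  -- The cost 3 of `c` matches its three arcs, so the slack that `x`, now of degree 3, provides in
  -- `G ∖ c` carries over.
  ... | yes deg≡4 = let b , b<ℓ , p = proj₂ (ih-∖ 0<deg-c) x (suc-injective deg-x) in
      3 + b
    , subst (3 + b <_) (sym length-G) (+-monoʳ-< 3 b<ℓ)
    , within-insert c p (≤-reflexive (cong (λ k → 3 * k + b) (cong₂ _⊓_ d⁺c d⁻c)))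
    where
    0<deg-c : 0 < deg c G
    0<deg-c = subst (0 <_) (sym (cong₂ _+_ d⁺c d⁻c)) z<s
    length-G : length G ≡ 3 + length (G ∖ c)
    length-G = trans (length-∖ o c) (trans (+-comm _ (deg c G)) (cong (_+ length (G ∖ c)) (cong₂ _+_ d⁺c d⁻c)))
    -- The arc `c → x` has no parallel copy, so `x` loses exactly one arc.
    mult≡1 : mult c x G ≡ 1
    mult≡1 = ≤-antisym (≤-trans (mult≤d⁺ c x) (≤-reflexive d⁺c)) (mult-positive c→x)
    deg-x : suc (deg x (G ∖ c)) ≡ 4
    deg-x = begin
      suc (d⁺ x (G ∖ c) + d⁻ x (G ∖ c))             ≡⟨ +-comm 1 _ ⟩
      d⁺ x (G ∖ c) + d⁻ x (G ∖ c) + 1               ≡⟨ +-assoc (d⁺ x (G ∖ c)) _ 1 ⟩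
      d⁺ x (G ∖ c) + (d⁻ x (G ∖ c) + 1)             ≡⟨ cong (λ k → d⁺ x (G ∖ c) + (d⁻ x (G ∖ c) + k)) mult≡1 ⟨
      d⁺ x (G ∖ c) + (d⁻ x (G ∖ c) + mult c x G)    ≡⟨ cong₂ _+_ (d⁺-∖-head o c→x) (sym (d⁻-∖-head o c→x)) ⟩
      deg x G                                       ≡⟨ deg≡4 ⟩
      4                                             ∎
      where open ≡-Reasoning
  -- Once x is deleted, c is a sink with two arcs.
  ... | no deg≢4 = _ , bound , delete₂ x c (≤-trans (d⁻-positive c→x) (m≤n+m _ _))
    where
    ℓ = length (G ∖ x ∖ c)
    d⁺-c : d⁺ c (G ∖ x) ≡ 0
    d⁺-c = n≤0⇒n≡0 (s≤s⁻¹ (subst (d⁺ c (G ∖ x) <_) (trans (sym (d⁺-∖-tail o c→x)) d⁺c) (m<m+n _ (mult-positive c→x))))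
    d⁻-c : d⁻ c (G ∖ x) ≡ 2
    d⁻-c = trans (d⁻-∖-tail o c→x) d⁻c
    bound : 3 * dmin x G + (3 * dmin c (G ∖ x) + ℓ) < length G
    bound = begin-strict
      3 * dmin x G + (3 * dmin c (G ∖ x) + ℓ)   ≡⟨ cong (λ k → 3 * dmin x G + (3 * (k ⊓ d⁻ c (G ∖ x)) + ℓ)) d⁺-c ⟩
      3 * dmin x G + ℓ                          <⟨ +-monoˡ-< ℓ (3*⊓<2+ (d⁺ x G) (d⁻ x G) (Δ≤5 x) deg≢4) ⟩
      2 + deg x G + ℓ                           ≡⟨ rearrange (deg x G) ℓ ⟩
      deg x G + (2 + ℓ)                         ≡⟨ cong (λ k → deg x G + (k + ℓ)) (cong₂ _+_ d⁺-c d⁻-c) ⟨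
      deg x G + (deg c (G ∖ x) + ℓ)             ≡⟨ length-∖₂ x c ⟨
      length G                                  ∎
      where
      open ≤-Reasoning
      rearrange : ∀ a b → 2 + a + b ≡ a + (2 + b)
      rearrange = solve-∀

  slack-pendant : ∀ {v} → 0 < deg v G → dmin v G ≡ 0 → Slack G
  slack-pendant {v} 0<d dmin≡0 = length (G ∖ v) , length-∖-< o 0<d
    , within-insert v (proj₁ (ih-∖ 0<d)) (≤-reflexive (cong (λ k → 3 * k + length (G ∖ v)) dmin≡0))

  -- An in-neighbour `u` is either reducible by itself, or is left with slack once `a` is deleted,
  -- or is deleted together with `a`.
  within-2-3 : ∀ {a} → d⁻ a G ≡ 2 → d⁺ a G ≡ 3 → Within G (length G)
  within-2-3 {a} d⁻a d⁺a with inNeighbour {G = G} {a} (subst (0 <_) (sym d⁻a) z<s)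
  ... | u , u→a = by-kind (degreeKind (d⁺ u G) (d⁻ u G) (Δ≤5 u))
    where
    0<deg-u : 0 < deg u G
    0<deg-u = ≤-trans (d⁺-positive u→a) (m≤m+n _ _)
    0<deg-a : 0 < deg a G
    0<deg-a = ≤-trans (d⁻-positive u→a) (m≤n+m _ _)
    -- The first vertex costs 6 for 5 arcs. The second has degrees `i` and 3 when its turn comes,
    -- costing 3`i` for `i` + 3 arcs; at worst this is 9 for 9.
    2-3-cheap : ∀ {i j x y} → dmin x G ≡ 2 → deg x G ≡ 5 → i ≤ 1 → j ≡ 3 →
                dmin y (G ∖ x) ≡ i ⊓ j → deg y (G ∖ x) ≡ i + j →
                3 * dmin x G + 3 * dmin y (G ∖ x) ≤ deg x G + deg y (G ∖ x)
    2-3-cheap p q z≤n       refl r s rewrite p | q | r | s = s≤s (s≤s (s≤s (s≤s (s≤s (s≤s z≤n)))))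
    2-3-cheap p q (s≤s z≤n) refl r s rewrite p | q | r | s = ≤-refl
    by-kind : DegreeKind (d⁺ u G) (d⁻ u G) → Within G (length G)
    by-kind (cheap h)  = delete-cheap 0<deg-u h
    by-kind (pass p q) = contract-pass p q
    -- If both out-arcs of `u` end in `a`, then `u` becomes a sink with two arcs, and the total is 6
    -- for 7 arcs. Otherwise `u` keeps degree 3 and supplies the missing unit as slack.
    by-kind (even d⁻u d⁺u) with d⁺ u (G ∖ a) in eq
    ... | 0 = delete₂-cheap a u 0<deg-a (begin
      3 * dmin a G + 3 * dmin u (G ∖ a)
        ≡⟨ cong₂ (λ k l → 3 * k + 3 * l) (cong₂ _⊓_ d⁺a d⁻a) (cong (_⊓ d⁻ u (G ∖ a)) eq) ⟩
      6                                    ≤⟨ n≤1+n 6 ⟩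
      7                                    ≡⟨ cong₂ _+_ (cong₂ _+_ d⁺a d⁻a) (cong₂ _+_ eq (trans (d⁻-∖-tail o u→a) d⁻u)) ⟨
      deg a G + deg u (G ∖ a)              ∎)
      where open ≤-Reasoning
    ... | suc (suc k) = contradiction
      (subst (3 ≤_) (trans (sym (d⁺-∖-tail o u→a)) d⁺u)
        (+-mono-≤ (≤-trans (s≤s (s≤s z≤n)) (≤-reflexive (sym eq))) (mult-positive u→a))) λ { (s≤s (s≤s ())) }
    ... | 1 = let b , b<ℓ , p = proj₂ (ih-∖ 0<deg-a) u (cong₂ _+_ eq (trans (d⁻-∖-tail o u→a) d⁻u)) in
      within-insert a p (begin
        3 * dmin a G + b             ≡⟨ cong (λ k → 3 * k + b) (cong₂ _⊓_ d⁺a d⁻a) ⟩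
        5 + suc b                    ≤⟨ +-monoʳ-≤ 5 b<ℓ ⟩
        5 + length (G ∖ a)           ≡⟨ cong (_+ length (G ∖ a)) (cong₂ _+_ d⁺a d⁻a) ⟨
        deg a G + length (G ∖ a)     ≡⟨ +-comm (deg a G) _ ⟩
        length (G ∖ a) + deg a G     ≡⟨ length-∖ o a ⟨
        length G                     ∎)
      where open ≤-Reasoning
    -- The order matters: `u` goes first here, so that `a` loses an in-arc, and `a` goes first in
    -- the next case, so that `u` loses an out-arc. Either way a degree 2 of the second vertex falls
    -- to at most 1.
    by-kind (2-in d⁻u d⁺u) = delete₂-cheap u a 0<deg-u
      (2-3-cheap (cong₂ _⊓_ d⁺u d⁻u) (cong₂ _+_ d⁺u d⁻u)
        (s≤s⁻¹ (subst (d⁻ a (G ∖ u) <_) (trans (sym (d⁻-∖-head o u→a)) d⁻a) (m<m+n _ (mult-positive u→a))))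
        (trans (d⁺-∖-head o u→a) d⁺a) (⊓-comm (d⁺ a (G ∖ u)) _) (+-comm (d⁺ a (G ∖ u)) _))
    by-kind (2-out d⁻u d⁺u) = delete₂-cheap a u 0<deg-a
      (2-3-cheap (cong₂ _⊓_ d⁺a d⁻a) (cong₂ _+_ d⁺a d⁻a)
        (s≤s⁻¹ (subst (d⁺ u (G ∖ a) <_) (trans (sym (d⁺-∖-tail o u→a)) d⁺u) (m<m+n _ (mult-positive u→a))))
        (trans (d⁻-∖-tail o u→a) d⁻u) refl refl)

module _ {G : Arcs n} (o : Oriented G) (Δ≤5 : MaxDegree≤5 G)
         (ih : ∀ (H : Arcs n) → length H < length G → WithinLength H) where
  open LengthStep o Δ≤5 ih

  private
    module Op = LengthStep (oriented-op o) (λ x → ≤-trans (≤-reflexive (deg-op x G)) (Δ≤5 x))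
      (λ H lt → ih H (subst (length H <_) (length-map swap G) lt))

  slack-step : ∀ v → deg v G ≡ 3 → Slack G
  slack-step v deg≡3 with d⁺ v G in p | d⁻ v G in q
  ... | 0 | 3 = slack-pendant {v} (subst (0 <_) (sym (cong₂ _+_ p q)) z<s) (cong₂ _⊓_ p q)
  ... | 1 | 2 = slack-2-1 q p
  ... | 2 | 1 = let b , b<ℓ , w = Op.slack-2-1 {v} (trans (d⁻-op v G) p) (trans (d⁺-op v G) q) in
    b , subst (b <_) (length-map swap G) b<ℓ , within-op w
  ... | 3 | 0 = slack-pendant {v} (subst (0 <_) (sym (cong₂ _+_ p q)) z<s) (cong₂ _⊓_ p q)

  length-step : Within G (length G)
  length-step with any? (λ v → (0 <? deg v G) ×-dec ¬? ((d⁻ v G ℕ.≟ 2) ×-dec (d⁺ v G ℕ.≟ 2)))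
  ... | yes (v , 0<d , ¬even) = by-kind (degreeKind (d⁺ v G) (d⁻ v G) (Δ≤5 v))
    where
    by-kind : DegreeKind (d⁺ v G) (d⁻ v G) → Within G (length G)
    by-kind (cheap h)   = delete-cheap 0<d h
    by-kind (pass p q)  = contract-pass p q
    by-kind (even p q)  = contradiction (p , q) ¬even
    by-kind (2-in p q)  = within-2-3 p q
    by-kind (2-out p q) = within-op (subst (Within (op G)) (length-map swap G)
      (Op.within-2-3 {v} (trans (d⁻-op v G) q) (trans (d⁺-op v G) p)))
  -- Every vertex is isolated or of type (2, 2). The weight is at most the number of arcs, as each
  -- minimum is at most the out-degree.
  ... | no all-even = weaken (within-weight G o sparse) (weight≤length G)
    where
    sparse : Sparse G
    sparse x with deg x G in eq | (d⁻ x G ℕ.≟ 2) ×-dec (d⁺ x G ℕ.≟ 2)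
    ... | _     | yes (p , q) = ≤-reflexive q , ≤-reflexive p
    ... | suc _ | no ¬even    = contradiction (x , subst (0 <_) (sym eq) z<s , ¬even) all-even
    ... | 0     | no _        = ≤-trans (≤-trans (m≤m+n _ _) (≤-reflexive eq)) z≤n
                              , ≤-trans (≤-trans (m≤n+m _ _) (≤-reflexive eq)) z≤n

within-length : (G : Arcs n) → WithinLength G
within-length G = go G (<-wellFounded (length G))
  where
  go : ∀ G → Acc _<_ (length G) → WithinLength G
  go G (acc rs) o Δ≤5 = length-step o Δ≤5 ih , slack-step o Δ≤5 ih
    where
    ih : ∀ H → length H < length G → WithinLength H
    ih H H<G = go H (rs H<G)

-- Feedback arc sets from rankings

arcs : ∀ {n m} → Digraph (Fin n) (Fin m) → Arcs n
arcs {m = m} D = map (λ e → src D e , tgt D e) (allFin m)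

length-arcs : ∀ {n m} (D : Digraph (Fin n) (Fin m)) → length (arcs D) ≡ m
length-arcs {m = m} D = trans (length-map _ (allFin m)) (length-tabulate {n = m} (λ e → e))

-- Two opposite arcs form a directed cycle of length 2. Their sources differ because the source of
-- `f` is the target of `e`, and `e` is not a loop.
oriented-arcs : ∀ {n m} (D : Digraph (Fin n) (Fin m)) → IsOriented D → Oriented (arcs D)
oriented-arcs {m = m} D o p q with ∈-map⁻ _ p | ∈-map⁻ _ q
... | e , _ , refl | f , _ , eq = no2Cycles o c record
  { consecutive = λ { zero → sym fs } ; closed = ft ; simple = λ {i} {j} → simple′ i j }
  where
  fs : src D f ≡ tgt D e
  fs = sym (cong proj₁ eq)
  ft : tgt D f ≡ src D e
  ft = sym (cong proj₂ eq)
  c : Fin 2 → Fin m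
  c zero       = e
  c (suc zero) = f
  simple′ : ∀ i j → src D (c i) ≡ src D (c j) → i ≡ j
  simple′ zero       zero       _ = refl
  simple′ zero       (suc zero) h = contradiction (trans h fs) (noLoops o e)
  simple′ (suc zero) zero       h = contradiction (trans (sym h) fs) (noLoops o e)
  simple′ (suc zero) (suc zero) _ = refl

length-filter : ∀ {A : Set} {P : A → Set} (P? : Decidable P) xs →
                length (filter P? xs) ≡ ∑ (λ x → ⟦ P? x ⟧) xs
length-filter P? xs = trans (sym (∑-1 (filter P? xs)))
  (trans (∑-filter P? _ xs) (∑-cong xs λ {x} _ → *-identityʳ ⟦ P? x ⟧))

opaque
  unfolding d⁺ d⁻

  deg-arcs : ∀ {n m} (D : Digraph (Fin n) (Fin m)) v → deg v (arcs D) ≡ degree D v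
  deg-arcs {m = m} D v = sym (cong₂ _+_
    (trans (length-filter (λ e → src D e ≟ v) (allFin m)) (sym (∑-map (λ e → ⟦ proj₁ e ≟ v ⟧) _ (allFin m))))
    (trans (length-filter (λ e → tgt D e ≟ v) (allFin m)) (sym (∑-map (λ e → ⟦ proj₂ e ≟ v ⟧) _ (allFin m)))))

degree≤Δ : ∀ {n m} (D : Digraph (Fin n) (Fin m)) v → degree D v ≤ Δ D
degree≤Δ {n} D v = All.lookup (xs≤max 0 (map (degree D) (allFin n))) (∈-map⁺ (degree D) (∈-allFin v))

subset : ∀ {m} {P : Fin m → Set} → Decidable P → Subset m
subset P? = Vec.tabulate (does ∘ P?)

∣subset∣ : ∀ {m} {P : Fin m → Set} (P? : Decidable P) → ∣ subset P? ∣ ≡ ∑ (λ e → ⟦ P? e ⟧) (allFin m)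
∣subset∣ {zero}  P? = refl
∣subset∣ {suc m} P? with P? zero
... | yes _ = cong suc (trans (∣subset∣ (P? ∘ suc)) (sym (∑-tabulate (λ e → ⟦ P? e ⟧) suc)))
... | no _  = trans (∣subset∣ (P? ∘ suc)) (sym (∑-tabulate (λ e → ⟦ P? e ⟧) suc))

∉subset : ∀ {m} {P : Fin m → Set} (P? : Decidable P) {e} → ¬ (subset P? Vec.[ e ]= true) → ¬ P e
∉subset P? {e} e∉ p = e∉ (Vec.lookup⇒[]= e _ (trans (Vec.lookup∘tabulate (does ∘ P?) e) (dec-true (P? e) p)))

-- Ranks climb strictly along the arcs, but the last arc of a cycle returns to the first vertex.
ranking⇒acyclic : {V A : Set} (G : Digraph V A) (r : V → ℕ) → (∀ e → r (src G e) < r (tgt G e)) → Acyclic G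
ranking⇒acyclic G r increasing {k} c C = <-irrefl refl (begin-strict
  r (src G (c zero))       ≤⟨ climb (fromℕ k) ⟩
  r (src G (c (fromℕ k)))  <⟨ increasing (c (fromℕ k)) ⟩
  r (tgt G (c (fromℕ k)))  ≡⟨ cong r (closed C) ⟩
  r (src G (c zero))       ∎)
  where
  open ≤-Reasoning
  step : ∀ i → r (src G (c (inject₁ i))) < r (src G (c (suc i)))
  step i = ≤-trans (increasing (c (inject₁ i))) (≤-reflexive (cong r (consecutive C i)))
  climb : ∀ i → r (src G (c zero)) ≤ r (src G (c i))
  climb = induction (λ i → r (src G (c zero)) ≤ r (src G (c i))) ≤-refl λ i h → ≤-trans h (<⇒≤ (step i))
    where
    induction : ∀ {k} (P : Fin (suc k) → Set) → P zero → (∀ i → P (inject₁ i) → P (suc i)) → ∀ i → P i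
    induction P p₀ ps zero = p₀
    induction {suc k} P p₀ ps (suc i) = ps i (induction (P ∘ inject₁) p₀ (ps ∘ inject₁) i)

opaque
  unfolding backward

  -- Ties count as backward, so every arc outside the backward set strictly increases the rank.
  fas≤backward : ∀ {n m} (D : Digraph (Fin n) (Fin m)) r → fas D ≤ backward r (arcs D)
  fas≤backward {m = m} D r = begin
    fas D                             ≤⟨ proj₂ (proj₂ (minimumFeedbackArcSet D)) (subset back?) acyclic ⟩
    ∣ subset back? ∣                  ≡⟨ ∣subset∣ back? ⟩
    ∑ (λ e → ⟦ back? e ⟧) (allFin m)  ≡⟨ ∑-map _ _ (allFin m) ⟨
    backward r (arcs D)               ∎
    where
    open ≤-Reasoning
    back? : ∀ e → Dec (r (tgt D e) ≤ r (src D e))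
    back? e = r (tgt D e) ≤? r (src D e)
    acyclic : IsFeedbackArcSet D (subset back?)
    acyclic = ranking⇒acyclic (deleteArcs D (subset back?)) r λ (e , e∉F) → ≰⇒> (∉subset back? e∉F)

theorem2 : ∀ {n m : ℕ} (D : Digraph (Fin n) (Fin m)) → IsOriented D → Δ D ≤ 5 → 3 * fas D ≤ m
theorem2 {m = m} D o Δ≤5 = begin
  3 * fas D                 ≤⟨ *-monoʳ-≤ 3 (fas≤backward D r) ⟩
  3 * backward r (arcs D)   ≤⟨ few ⟩
  length (arcs D)           ≡⟨ length-arcs D ⟩
  m                         ∎
  where
  open ≤-Reasoning
  ranked : Within (arcs D) (length (arcs D))
  ranked = proj₁ (within-length (arcs D) (oriented-arcs D o)
    λ v → ≤-trans (≤-reflexive (deg-arcs D v)) (≤-trans (degree≤Δ D v) Δ≤5))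
  r   = proj₁ ranked
  few = proj₂ ranked
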